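{- Let $f$ and $g$ be multiplicative functions such that $S_f(x)\ll x^\alpha$, and suppose that $\hat{\mathbb{D}}_{\beta,k}(f,g)<\infty$ for some $\beta$ and some positive integer $k$. Suppose additionally that $f(n)=o(n^\delta)$ and $g(n)=o(n^\delta)$ for some $\delta>0$. Let $h$ be defined by $g=f*h$. If $\sigma>1/(k+1)+\delta$ is such that $\sigma\ge\max(\alpha,\beta)$, then there is $Y>0$ such that if $\hat H_Y(\sigma)$ is convergent, then $S_g(x)\ll x^\sigma$.
   Context: $S_f(x):=\sum_{n\le x}f(n)$. For multiplicative $f,g$ (not necessarily bounded), $\hat{\mathbb{D}}_{\beta,k}(f,g):=\sum_p\sum_{j=1}^k\frac{|f(p^j)-g(p^j)|}{p^{j\beta}}$ (sum over primes); $f,g$ are called $(\beta,k)$-strongly pretentious if this is finite. $(f*h)(n)=\sum_{dm=n}f(d)h(m)$. $\hat H_Y(\sigma):=\sum_{p\le Y}\sum_{k=1}^\infty\frac{|h(p^k)|}{p^{k\sigma}}$. -}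

module Defs where

open import Level using (0ℓ)
open import Algebra.Bundles using (CommutativeRing)
import Algebra.Properties.Semiring.Mult as SemiringMult
open import Data.List.Base using (List; foldr; map; filter; upTo; cartesianProduct)
open import Data.Nat.Base as ℕ using (ℕ; suc)
import Data.Nat.Properties as ℕ
open import Data.Nat.Coprimality using (Coprime)
open import Data.Nat.Primality using (Prime; prime?)
open import Data.Product using (∃; _×_; proj₁; proj₂)
open import Relation.Binary.Core using (Rel)
open import Relation.Binary.Structures using (IsDecTotalOrder)
import Relation.Binary.Construct.NonStrictToStrict as ToStrict
open import Relation.Nullary using (¬_; yes; no)

-- The standard library has no real numbers.  They enter as an arbitrary
-- complete ordered field; classically this determines ℝ up to isomorphism.
-- Equality is a setoid equality, so that Cauchy sequences of rationals
-- qualify (given excluded middle) without quotienting.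
record CompleteOrderedField : Set₁ where
  infix  4 _≤_ _<_
  infix  8 _⁻¹
  infixl 7 _/_
  infixl 6 _-_

  field
    commutativeRing : CommutativeRing 0ℓ 0ℓ

  open CommutativeRing commutativeRing public
    renaming (Carrier to ℝ) hiding (_-_)

  field
    _≤_             : Rel ℝ 0ℓ
    isDecTotalOrder : IsDecTotalOrder _≈_ _≤_
    +-monoˡ-≤       : ∀ z {x y} → x ≤ y → x + z ≤ y + z
    *-nonNegative   : ∀ {x y} → 0# ≤ x → 0# ≤ y → 0# ≤ x * y
    0≉1             : ¬ (0# ≈ 1#)
    -- total, with an unspecified value at 0
    _⁻¹             : ℝ → ℝ
    *-inverseʳ      : ∀ {x} → ¬ (x ≈ 0#) → x * x ⁻¹ ≈ 1#
    supremum        : (P : ℝ → Set) → ∃ P →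
                      (∃ λ u → ∀ x → P x → x ≤ u) →
                      ∃ λ s → (∀ x → P x → x ≤ s) ×
                              (∀ u → (∀ x → P x → x ≤ u) → s ≤ u)

  open SemiringMult semiring public using () renaming (_×_ to _·_)

  fromℕ : ℕ → ℝ
  fromℕ n = n · 1#

  -- Classically a consequence of supremum; it is a field because the
  -- bound itself is needed to compute the range of a sum over n ≤ x.
  field
    archimedean : ∀ x → ∃ λ n → x ≤ fromℕ n

  open IsDecTotalOrder isDecTotalOrder public using (_≤?_)

  _<_ : Rel ℝ 0ℓ
  _<_ = ToStrict._<_ _≈_ _≤_

  _-_ _/_ : ℝ → ℝ → ℝ
  x - y = x + (- y)
  x / y = x * y ⁻¹

-- Real powers x ^ a of positive x.  For x > 0 these laws have exactly one
-- solution: for fixed x ≥ 1, ^-+ and ^-1 determine x ^ a at rational a,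
-- ^-monoʳ extends this to real a, and ^-* reduces x < 1 to 1 / x.
-- Values at x ≤ 0 are unspecified.
record RealPower (R : CompleteOrderedField) : Set where
  open CompleteOrderedField R
  infixr 8 _^_
  field
    _^_     : ℝ → ℝ → ℝ
    ^-cong  : ∀ {x y a b} → 0# < x → x ≈ y → a ≈ b → x ^ a ≈ y ^ b
    ^-pos   : ∀ {x} a → 0# < x → 0# < x ^ a
    ^-1     : ∀ {x} → 0# < x → x ^ 1# ≈ x
    ^-+     : ∀ {x} a b → 0# < x → x ^ (a + b) ≈ x ^ a * x ^ b
    ^-*     : ∀ {x y} a → 0# < x → 0# < y → (x * y) ^ a ≈ x ^ a * y ^ a
    ^-monoʳ : ∀ {x a b} → 1# ≤ x → a ≤ b → x ^ a ≤ x ^ b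

[1‥_] : ℕ → List ℕ
[1‥ n ] = map suc (upTo n)

primesUpTo : ℕ → List ℕ
primesUpTo n = filter prime? [1‥ n ]

module Notions (R : CompleteOrderedField) (power : RealPower R) where
  open CompleteOrderedField R public
  open RealPower power public

  sumℝ : {A : Set} → List A → (A → ℝ) → ℝ
  sumℝ xs a = foldr (λ x s → a x + s) 0# xs

  Converges : (ℕ → ℝ) → Set
  Converges u = ∃ λ L → ∀ ε → 0# < ε →
    ∃ λ N → ∀ n → N ℕ.≤ n → (u n - L < ε) × (L - u n < ε)

  record ℂ : Set where
    constructor _+i_
    field
      re im : ℝ
  open ℂ public

  infix  4 _≈ᶜ_
  infixl 6 _+ᶜ_ _-ᶜ_
  infixl 7 _*ᶜ_

  _≈ᶜ_ : Rel ℂ 0ℓ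
  z ≈ᶜ w = (re z ≈ re w) × (im z ≈ im w)

  0ᶜ 1ᶜ : ℂ
  0ᶜ = 0# +i 0#
  1ᶜ = 1# +i 0#

  _+ᶜ_ _-ᶜ_ _*ᶜ_ : ℂ → ℂ → ℂ
  z +ᶜ w = (re z + re w) +i (im z + im w)
  z -ᶜ w = (re z - re w) +i (im z - im w)
  z *ᶜ w = (re z * re w - im z * im w) +i (re z * im w + im z * re w)

  √ : ℝ → ℝ
  √ q with q ≤? 0#
  ... | yes _ = 0#
  ... | no  _ = q ^ (1# / fromℕ 2)

  ∣_∣ : ℂ → ℝ
  ∣ z ∣ = √ (re z * re z + im z * im z)

  sumℂ : {A : Set} → List A → (A → ℂ) → ℂ
  sumℂ xs a = foldr (λ x s → a x +ᶜ s) 0ᶜ xs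

  -- Only the values at n ≥ 1 are meaningful.
  Arithmetic : Set
  Arithmetic = ℕ → ℂ

  Multiplicative : Arithmetic → Set
  Multiplicative f = (f 1 ≈ᶜ 1ᶜ) ×
    (∀ m n → 1 ℕ.≤ m → 1 ℕ.≤ n → Coprime m n → f (m ℕ.* n) ≈ᶜ f m *ᶜ f n)

  -- The Archimedean bound only makes the range finite; the filter then
  -- keeps precisely the n ≥ 1 with n ≤ x.
  S : Arithmetic → ℝ → ℂ
  S f x = sumℂ (filter (λ n → fromℕ n ≤? x) [1‥ proj₁ (archimedean x) ]) f

  infix 4 _≪[x^_]
  _≪[x^_] : (ℝ → ℂ) → ℝ → Set
  F ≪[x^ α ] = ∃ λ C → ∀ x → 1# ≤ x → ∣ F x ∣ ≤ C * x ^ α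

  infix 4 _=o[n^_]
  _=o[n^_] : Arithmetic → ℝ → Set
  f =o[n^ δ ] = ∀ ε → 0# < ε →
    ∃ λ N → ∀ n → N ℕ.≤ n → ∣ f n ∣ ≤ ε * fromℕ n ^ δ

  infixl 7 _⋆_
  _⋆_ : Arithmetic → Arithmetic → Arithmetic
  (f ⋆ h) n =
    sumℂ (filter (λ dm → proj₁ dm ℕ.* proj₂ dm ℕ.≟ n)
                 (cartesianProduct [1‥ n ] [1‥ n ]))
         (λ dm → f (proj₁ dm) *ᶜ h (proj₂ dm))

  infix 4 _≗⁺_
  _≗⁺_ : Arithmetic → Arithmetic → Set
  f ≗⁺ g = ∀ n → 1 ℕ.≤ n → f n ≈ᶜ g n

  StronglyPretentious : ℝ → ℕ → Arithmetic → Arithmetic → Set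
  StronglyPretentious β k f g = Converges λ N →
    sumℝ (primesUpTo N) λ p →
    sumℝ [1‥ k ] λ j →
      ∣ f (p ℕ.^ j) -ᶜ g (p ℕ.^ j) ∣ / fromℕ p ^ (fromℕ j * β)

  -- The outer sum over p ≤ Y is finite and all terms are nonnegative, so
  -- Ĥ_Y(σ) converges when each of its inner series does.
  ĤConvergent : Arithmetic → ℝ → ℝ → Set
  ĤConvergent h Y σ = ∀ p → Prime p → fromℕ p ≤ Y → Converges λ K →
    sumℝ [1‥ K ] λ j → ∣ h (p ℕ.^ j) ∣ / fromℕ p ^ (fromℕ j * σ)

module Submission where

-- Pass from f to g one prime at a time: replacing the values of F at powers of
-- p by those of g is convolution with the part of h supported on powers of p,
-- so a bound |∑_{n ≤ N} F n| ≤ K N^σ turns into one with the constant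
-- K (1 + ∑_j |h(p^j)| p^{-jσ}), and after all primes p ≤ N one has reached
-- g on [1, N].  This needs neither Euler products nor multiplicativity of h.
-- It remains to bound ∏_p (1 + ∑_j |h(p^j)| p^{-jσ}).  The finitely many p ≤ Y
-- are covered by the convergence of Ĥ_Y(σ).  For p > Y all |f(p^j)| are at most
-- ε p^{jδ}, and the recursion for h(p^j) from g = f * h gives
-- ∑_j |h(p^j)| p^{-jσ} ≤ 2 ∑_j |f(p^j) - g(p^j)| p^{-jσ}, where the terms j ≤ k
-- are part of the pretentious distance and those with j > k are
-- O(ε p^{-(k+1)(σ-δ)}), with exponent (k+1)(σ-δ) > 1.
-- Small ε and large Y make the sum over p > Y at most 1/2, so the product over
-- p > Y is at most 2.

-- The recursion bounds the sum of |h(p^j)| p^(-jσ) only if `ε` in |f(p^i)| ≤ ε p^(iδ) is small, and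
-- f(n) = o(n^δ) gives this only for large p; at small primes the series may diverge, which is why
-- Ĥ_Y(σ) enters as a hypothesis. What makes a prime large depends on f, g and the exponents alone,
-- so Y is fixed before anything is assumed about Ĥ_Y(σ).
--
-- Only finite sums of values of h occur. Exponents are cut off at `J`, and `J` is set to N when g
-- is summed up to N, so every constant has to be uniform in `J`. In return a local sum X can be
-- absorbed: X ≤ D + X/2 gives X ≤ 2 D with no prior knowledge that the series converges.
--
-- Two elementary inequalities stand in for exponentials and integrals: the product of the 1 + a_i
-- is at most 1 / (1 - s) when s, the sum of the a_i ≥ 0, is below 1, and the sum of n^(-s) is at
-- most 1 / (1 - 2^(1-s)) for s > 1, by comparing pairs of terms.

open import Defs
open import Data.Nat.Base as ℕ using (ℕ; zero; suc)
open import Data.Product using (∃; ∃₂; _×_; _,_; proj₁; proj₂)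
open import Algebra.Bundles using (CommutativeRing; RawRing)
import Algebra.Properties.CommutativeSemiring.Exp
import Algebra.Properties.Ring
import Algebra.Properties.Semiring.Mult
import Algebra.Solver.Ring
open import Algebra.Solver.Ring.AlmostCommutativeRing using (AlmostCommutativeRing; fromCommutativeRing; _-Raw-AlmostCommutative⟶_)
open import Data.List.Base using (List; []; _∷_; _++_; foldr; map; filter; applyUpTo; cartesianProduct)
open import Data.List.Properties using (map-upTo)
open import Data.List.Relation.Unary.All using (_∷_)
open import Data.Maybe.Base using (Maybe; just; nothing)
open import Data.Nat.Coprimality as Coprime using (Coprime; coprime-divisor)
open import Data.Nat.DivMod using (_%_; m≡m%n+[m/n]*n; m%n<n; m/n*n≤m) renaming (_/_ to _/ᴺ_)
open import Data.Nat.Induction using (<-wellFounded)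
open import Data.Nat.ListAction using (product)
open import Data.Nat.Primality using (Prime; prime?; euclidsLemma; prime⇒nonZero; prime⇒nonTrivial; prime⇒irreducible; ¬prime[1])
open import Data.Nat.Primality.Factorisation using (factorise)
import Data.Nat.Properties as ℕ
open import Data.Sum using (inj₁; inj₂)
open import Function using (_∘_)
open import Induction.WellFounded using (Acc; acc)
open import Level using (0ℓ)
open import Relation.Binary.Bundles using (Poset)
import Relation.Binary.Construct.NonStrictToStrict as ToStrict
open import Relation.Binary.PropositionalEquality as ≡ using (_≡_; _≢_)
import Relation.Binary.Reasoning.PartialOrder
import Relation.Binary.Reasoning.Setoid
open import Relation.Binary.Structures using (IsDecTotalOrder)
open import Relation.Nullary using (¬_; Dec; yes; no; contradiction)
open import Relation.Unary using (Decidable)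

-- The coefficient (a , b) stands for the integer a − b, so that its image in
-- an abstract ring needs no case distinction on signs.
module IntegerSolver (R : CommutativeRing 0ℓ 0ℓ) where
  open CommutativeRing R hiding (_-_)
  open Algebra.Properties.Ring ring
  open Algebra.Properties.Semiring.Mult semiring using (×-homo-+; ×1-homo-*) renaming (_×_ to _·_)
  open Relation.Binary.Reasoning.Setoid setoid

  private
    -- Keeps coefficients canonical: (1 , 1) and (0 , 0) would give different
    -- normal forms to equal polynomials.
    normalise : ℕ × ℕ → ℕ × ℕ
    normalise (a , b) = a ℕ.∸ b , b ℕ.∸ a

    coefficients : RawRing 0ℓ 0ℓ
    coefficients = record
      { Carrier = ℕ × ℕ
      ; _≈_ = _≡_
      ; _+_ = λ (a , b) (c , d) → normalise (a ℕ.+ c , b ℕ.+ d)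
      ; _*_ = λ (a , b) (c , d) → normalise (a ℕ.* c ℕ.+ b ℕ.* d , a ℕ.* d ℕ.+ b ℕ.* c)
      ; -_ = λ (a , b) → b , a
      ; 0# = 0 , 0
      ; 1# = 1 , 0
      }

    R′ : AlmostCommutativeRing 0ℓ 0ℓ
    R′ = fromCommutativeRing R

    difference : ℕ × ℕ → Carrier
    difference (a , b) = a · 1# + - (b · 1#)

    difference-0 : difference (0 , 0) ≈ 0#
    difference-0 = -‿inverseʳ 0#

    difference-1 : difference (1 , 0) ≈ 1#
    difference-1 = trans (+-cong (+-identityʳ 1#) -0#≈0#) (+-identityʳ 1#)

    -- 0# and 1# are special cases so that they denote themselves in goals.
    ⟦_⟧ᶜ : ℕ × ℕ → Carrier
    ⟦ 0 , 0 ⟧ᶜ = 0#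
    ⟦ 1 , 0 ⟧ᶜ = 1#
    ⟦ x ⟧ᶜ = difference x

    ⟦⟧ᶜ-difference : ∀ x → ⟦ x ⟧ᶜ ≈ difference x
    ⟦⟧ᶜ-difference (0 , 0) = sym difference-0
    ⟦⟧ᶜ-difference (0 , suc b) = refl
    ⟦⟧ᶜ-difference (1 , 0) = sym difference-1
    ⟦⟧ᶜ-difference (1 , suc b) = refl
    ⟦⟧ᶜ-difference (suc (suc a) , b) = refl

    interchange : ∀ a b c d → (a + b) + (c + d) ≈ (a + c) + (b + d)
    interchange a b c d = begin
      (a + b) + (c + d) ≈⟨ +-assoc a b (c + d) ⟩
      a + (b + (c + d)) ≈⟨ +-congˡ (sym (+-assoc b c d)) ⟩
      a + ((b + c) + d) ≈⟨ +-congˡ (+-congʳ (+-comm b c)) ⟩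
      a + ((c + b) + d) ≈⟨ +-congˡ (+-assoc c b d) ⟩
      a + (c + (b + d)) ≈⟨ +-assoc a c (b + d) ⟨
      (a + c) + (b + d) ∎

    difference-≡ : ∀ a b c d → a ℕ.+ d ≡ c ℕ.+ b → difference (a , b) ≈ difference (c , d)
    difference-≡ a b c d a+d≡c+b = begin
      A + - B                 ≈⟨ +-identityʳ _ ⟨
      (A + - B) + 0#          ≈⟨ +-congˡ (-‿inverseʳ D) ⟨
      (A + - B) + (D + - D)   ≈⟨ interchange A (- B) D (- D) ⟩
      (A + D) + (- B + - D)   ≈⟨ +-cong A+D≈C+B (+-comm (- B) (- D)) ⟩
      (C + B) + (- D + - B)   ≈⟨ interchange C B (- D) (- B) ⟩
      (C + - D) + (B + - B)   ≈⟨ +-congˡ (-‿inverseʳ B) ⟩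
      (C + - D) + 0#          ≈⟨ +-identityʳ _ ⟩
      C + - D                 ∎
      where
      A = a · 1#
      B = b · 1#
      C = c · 1#
      D = d · 1#
      A+D≈C+B : A + D ≈ C + B
      A+D≈C+B = trans (sym (×-homo-+ 1# a d)) (trans (reflexive (≡.cong (_· 1#) a+d≡c+b)) (×-homo-+ 1# c b))

    difference-normalise : ∀ x → difference (normalise x) ≈ difference x
    difference-normalise (a , b) = difference-≡ (a ℕ.∸ b) (b ℕ.∸ a) a b
      (balance a b)
      where
      -- Both sides are the maximum of `a` and `b`.
      balance : ∀ a b → a ℕ.∸ b ℕ.+ b ≡ a ℕ.+ (b ℕ.∸ a)
      balance a       zero    = ≡.cong (a ℕ.+_) (≡.sym (ℕ.0∸n≡0 a))
      balance zero    (suc b) = ≡.refl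
      balance (suc a) (suc b) = ≡.trans (ℕ.+-suc (a ℕ.∸ b) b) (≡.cong suc (balance a b))

    difference-+ : ∀ a b c d → (a + c) + - (b + d) ≈ (a + - b) + (c + - d)
    difference-+ a b c d = begin
      (a + c) + - (b + d)     ≈⟨ +-congˡ (sym (-‿+-comm b d)) ⟩
      (a + c) + (- b + - d)   ≈⟨ interchange a c (- b) (- d) ⟩
      (a + - b) + (c + - d)   ∎

    difference-* : ∀ a b c d → (a * c + b * d) + - (a * d + b * c) ≈ (a + - b) * (c + - d)
    difference-* a b c d = begin
      (a * c + b * d) + - (a * d + b * c)     ≈⟨ difference-+ (a * c) (a * d) (b * d) (b * c) ⟩
      (a * c + - (a * d)) + (b * d + - (b * c)) ≈⟨ +-cong (+-congˡ (-‿distribʳ-* a d)) (+-comm _ _) ⟩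
      (a * c + a * - d) + (- (b * c) + b * d) ≈⟨ +-cong (sym (distribˡ a c (- d))) (+-cong (-‿distribˡ-* b c) neg-neg) ⟩
      a * (c + - d) + (- b * c + - b * - d)   ≈⟨ +-congˡ (sym (distribˡ (- b) c (- d))) ⟩
      a * (c + - d) + - b * (c + - d)         ≈⟨ distribʳ (c + - d) a (- b) ⟨
      (a + - b) * (c + - d)                   ∎
      where
      neg-neg : b * d ≈ - b * - d
      neg-neg = begin
        b * d         ≈⟨ -‿involutive (b * d) ⟨
        - - (b * d)   ≈⟨ -‿cong (-‿distribʳ-* b d) ⟩
        - (b * - d)   ≈⟨ -‿distribˡ-* b (- d) ⟩
        - b * - d     ∎

    morphism : coefficients -Raw-AlmostCommutative⟶ R′
    morphism = record
      { ⟦_⟧ = ⟦_⟧ᶜ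
      ; +-homo = λ x y → trans (⟦⟧ᶜ-difference (RawRing._+_ coefficients x y))
          (trans (+-homo x y) (sym (+-cong (⟦⟧ᶜ-difference x) (⟦⟧ᶜ-difference y))))
      ; *-homo = λ x y → trans (⟦⟧ᶜ-difference (RawRing._*_ coefficients x y))
          (trans (*-homo x y) (sym (*-cong (⟦⟧ᶜ-difference x) (⟦⟧ᶜ-difference y))))
      ; -‿homo = λ x → trans (⟦⟧ᶜ-difference (RawRing.-_ coefficients x)) (trans (-‿homo x) (-‿cong (sym (⟦⟧ᶜ-difference x))))
      ; 0-homo = refl
      ; 1-homo = refl
      }
      where
      +-homo : ∀ x y → difference (RawRing._+_ coefficients x y) ≈ difference x + difference y
      +-homo (a , b) (c , d) = trans (difference-normalise (a ℕ.+ c , b ℕ.+ d)) (trans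
        (+-cong (×-homo-+ 1# a c) (-‿cong (×-homo-+ 1# b d)))
        (difference-+ (a · 1#) (b · 1#) (c · 1#) (d · 1#)))

      *-homo : ∀ x y → difference (RawRing._*_ coefficients x y) ≈ difference x * difference y
      *-homo (a , b) (c , d) = trans (difference-normalise (a ℕ.* c ℕ.+ b ℕ.* d , a ℕ.* d ℕ.+ b ℕ.* c)) (trans
        (+-cong (trans (×-homo-+ 1# (a ℕ.* c) (b ℕ.* d)) (+-cong (×1-homo-* a c) (×1-homo-* b d)))
           (-‿cong (trans (×-homo-+ 1# (a ℕ.* d) (b ℕ.* c)) (+-cong (×1-homo-* a d) (×1-homo-* b c)))))
        (difference-* (a · 1#) (b · 1#) (c · 1#) (d · 1#)))

      -‿homo : ∀ x → difference (RawRing.-_ coefficients x) ≈ - difference x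
      -‿homo (a , b) = begin
        b · 1# + - (a · 1#)         ≈⟨ +-comm _ _ ⟩
        - (a · 1#) + b · 1#         ≈⟨ +-congˡ (sym (-‿involutive _)) ⟩
        - (a · 1#) + - - (b · 1#)   ≈⟨ -‿+-comm _ _ ⟩
        - (a · 1# + - (b · 1#))     ∎

    coefficients≟ : ∀ x y → Maybe (⟦ x ⟧ᶜ ≈ ⟦ y ⟧ᶜ)
    coefficients≟ (a , b) (c , d) with a ℕ.+ d ℕ.≟ c ℕ.+ b
    ... | no _ = nothing
    ... | yes a+d≡c+b = just (trans (⟦⟧ᶜ-difference (a , b))
      (trans (difference-≡ a b c d a+d≡c+b) (sym (⟦⟧ᶜ-difference (c , d)))))

  open Algebra.Solver.Ring coefficients R′ morphism coefficients≟ public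
    using (solve; _:=_; _:+_; _:*_; :-_; _:-_; con; Polynomial)

  𝟎 𝟏 : ∀ {n} → Polynomial n
  𝟎 = con (0 , 0)
  𝟏 = con (1 , 0)

-- Order arithmetic, embedded natural numbers and integer powers in an ordered field.

module OrderedField (R : CompleteOrderedField) where
  open CompleteOrderedField R
  open IntegerSolver commutativeRing public
  open IsDecTotalOrder isDecTotalOrder public
    using (antisym; total; isPartialOrder)
    renaming (refl to ≤-refl; reflexive to ≤-reflexive; trans to ≤-trans)
  open ToStrict _≈_ _≤_ public using (<⇒≤; <⇒≉)
  open Algebra.Properties.Semiring.Mult semiring public using (×-homo-+; ×1-homo-*)
  open Algebra.Properties.CommutativeSemiring.Exp commutativeSemiring public
    using (^-homo-*; ^-congˡ; ^-distrib-*) renaming (_^_ to _^ⁿ_)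

  ≤-poset : Poset 0ℓ 0ℓ 0ℓ
  ≤-poset = record { isPartialOrder = isPartialOrder }

  module ≤R = Relation.Binary.Reasoning.PartialOrder ≤-poset
  open ≤R

  <⇒≱ : ∀ {x y} → x < y → ¬ (y ≤ x)
  <⇒≱ = ToStrict.<⇒≱ _≈_ _≤_ antisym

  ≰⇒> : ∀ {x y} → ¬ (x ≤ y) → y < x
  ≰⇒> = ToStrict.≰⇒> _≈_ _≤_ sym ≤-reflexive total

  +-monoʳ-≤ : ∀ z {x y} → x ≤ y → z + x ≤ z + y
  +-monoʳ-≤ z {x} {y} x≤y = begin
    z + x ≈⟨ +-comm z x ⟩
    x + z ≤⟨ +-monoˡ-≤ z x≤y ⟩
    y + z ≈⟨ +-comm y z ⟩
    z + y ∎

  +-mono-≤ : ∀ {a b c d} → a ≤ b → c ≤ d → a + c ≤ b + d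
  +-mono-≤ {b = b} {c} a≤b c≤d = ≤-trans (+-monoˡ-≤ c a≤b) (+-monoʳ-≤ b c≤d)

  +-nonNegative : ∀ {x y} → 0# ≤ x → 0# ≤ y → 0# ≤ x + y
  +-nonNegative {x} {y} 0≤x 0≤y = begin
    0#      ≈⟨ +-identityˡ 0# ⟨
    0# + 0# ≤⟨ +-mono-≤ 0≤x 0≤y ⟩
    x + y   ∎

  +-cancelʳ-≤ : ∀ z {x y} → x + z ≤ y + z → x ≤ y
  +-cancelʳ-≤ z {x} {y} h = begin
    x         ≈⟨ solve 2 (λ x z → x := (x :+ z) :- z) refl x z ⟩
    x + z - z ≤⟨ +-monoˡ-≤ (- z) h ⟩
    y + z - z ≈⟨ solve 2 (λ x z → (x :+ z) :- z := x) refl y z ⟩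
    y         ∎

  x≤y+x : ∀ {x y} → 0# ≤ y → x ≤ y + x
  x≤y+x {x} {y} 0≤y = begin
    x       ≈⟨ +-identityˡ x ⟨
    0# + x  ≤⟨ +-monoˡ-≤ x 0≤y ⟩
    y + x   ∎

  x≤x+y : ∀ {x y} → 0# ≤ y → x ≤ x + y
  x≤x+y 0≤y = ≤-trans (x≤y+x 0≤y) (≤-reflexive (+-comm _ _))

  x≤y⇒0≤y-x : ∀ {x y} → x ≤ y → 0# ≤ y - x
  x≤y⇒0≤y-x {x} {y} x≤y = begin
    0#    ≈⟨ -‿inverseʳ x ⟨
    x - x ≤⟨ +-monoˡ-≤ (- x) x≤y ⟩
    y - x ∎

  0≤y-x⇒x≤y : ∀ {x y} → 0# ≤ y - x → x ≤ y
  0≤y-x⇒x≤y {x} {y} h = begin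
    x         ≤⟨ x≤y+x h ⟩
    y - x + x ≈⟨ solve 2 (λ x y → (y :- x) :+ x := y) refl x y ⟩
    y         ∎

  x<y⇒0<y-x : ∀ {x y} → x < y → 0# < y - x
  x<y⇒0<y-x {x} {y} (x≤y , x≉y) = x≤y⇒0≤y-x x≤y , λ 0≈ → x≉y (begin-equality
    x           ≈⟨ +-identityˡ x ⟨
    0# + x      ≈⟨ +-congʳ 0≈ ⟩
    (y - x) + x ≈⟨ solve 2 (λ x y → (y :- x) :+ x := y) refl x y ⟩
    y           ∎)

  *-monoˡ-≤ : ∀ {c x y} → 0# ≤ c → x ≤ y → c * x ≤ c * y
  *-monoˡ-≤ {c} {x} {y} 0≤c x≤y = 0≤y-x⇒x≤y (begin
    0#            ≤⟨ *-nonNegative 0≤c (x≤y⇒0≤y-x x≤y) ⟩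
    c * (y - x)   ≈⟨ solve 3 (λ c x y → c :* (y :- x) := c :* y :- c :* x) refl c x y ⟩
    c * y - c * x ∎)

  *-monoʳ-≤ : ∀ {c x y} → 0# ≤ c → x ≤ y → x * c ≤ y * c
  *-monoʳ-≤ {c} {x} {y} 0≤c x≤y = begin
    x * c ≈⟨ *-comm x c ⟩
    c * x ≤⟨ *-monoˡ-≤ 0≤c x≤y ⟩
    c * y ≈⟨ *-comm c y ⟩
    y * c ∎

  *-mono-≤ : ∀ {a b c d} → 0# ≤ b → 0# ≤ c → a ≤ b → c ≤ d → a * c ≤ b * d
  *-mono-≤ 0≤b 0≤c a≤b c≤d = ≤-trans (*-monoʳ-≤ 0≤c a≤b) (*-monoˡ-≤ 0≤b c≤d)

  0≤x*x : ∀ x → 0# ≤ x * x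
  0≤x*x x with total 0# x
  ... | inj₁ 0≤x = *-nonNegative 0≤x 0≤x
  ... | inj₂ x≤0 = begin
    0#                    ≤⟨ *-nonNegative 0≤-x 0≤-x ⟩
    (0# - x) * (0# - x)   ≈⟨ solve 1 (λ x → (𝟎 :- x) :* (𝟎 :- x) := x :* x) refl x ⟩
    x * x                 ∎
    where
    0≤-x : 0# ≤ 0# - x
    0≤-x = x≤y⇒0≤y-x x≤0

  0≤1 : 0# ≤ 1#
  0≤1 = ≤-trans (0≤x*x 1#) (≤-reflexive (*-identityˡ 1#))

  0<1 : 0# < 1#
  0<1 = 0≤1 , 0≉1

  <-≤-trans : ∀ {x y z} → x < y → y ≤ z → x < z
  <-≤-trans {x} {y} {z} x<y y≤z = begin-strict
    x <⟨ x<y ⟩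
    y ≤⟨ y≤z ⟩
    z ∎

  ≤-<-trans : ∀ {x y z} → x ≤ y → y < z → x < z
  ≤-<-trans {x} {y} {z} x≤y y<z = begin-strict
    x ≤⟨ x≤y ⟩
    y <⟨ y<z ⟩
    z ∎

  positive⇒≉0 : ∀ {x} → 0# < x → ¬ (x ≈ 0#)
  positive⇒≉0 0<x x≈0 = <⇒≉ 0<x (sym x≈0)

  *-inverseˡ : ∀ {x} → 0# < x → x ⁻¹ * x ≈ 1#
  *-inverseˡ 0<x = trans (*-comm _ _) (*-inverseʳ (positive⇒≉0 0<x))

  *-positive : ∀ {x y} → 0# < x → 0# < y → 0# < x * y
  *-positive {x} {y} 0<x 0<y = *-nonNegative (<⇒≤ 0<x) (<⇒≤ 0<y) , λ 0≈xy → <⇒≉ 0<y (begin-equality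
    0#              ≈⟨ zeroʳ (x ⁻¹) ⟨
    x ⁻¹ * 0#       ≈⟨ *-congˡ 0≈xy ⟩
    x ⁻¹ * (x * y)  ≈⟨ *-assoc _ _ _ ⟨
    x ⁻¹ * x * y    ≈⟨ *-congʳ (*-inverseˡ 0<x) ⟩
    1# * y          ≈⟨ *-identityˡ y ⟩
    y               ∎)

  ⁻¹-nonNegative : ∀ {x} → 0# < x → 0# ≤ x ⁻¹
  ⁻¹-nonNegative {x} 0<x with total 0# (x ⁻¹)
  ... | inj₁ h = h
  ... | inj₂ h = contradiction 1≤0 (<⇒≱ 0<1)
    where
    1≤0 : 1# ≤ 0#
    1≤0 = begin
      1#       ≈⟨ *-inverseʳ (positive⇒≉0 0<x) ⟨
      x * x ⁻¹ ≤⟨ *-monoˡ-≤ (<⇒≤ 0<x) h ⟩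
      x * 0#   ≈⟨ zeroʳ x ⟩
      0#       ∎

  ⁻¹-positive : ∀ {x} → 0# < x → 0# < x ⁻¹
  ⁻¹-positive {x} 0<x = ⁻¹-nonNegative 0<x , λ 0≈ → 0≉1 (begin-equality
    0#       ≈⟨ zeroʳ x ⟨
    x * 0#   ≈⟨ *-congˡ 0≈ ⟩
    x * x ⁻¹ ≈⟨ *-inverseʳ (positive⇒≉0 0<x) ⟩
    1#       ∎)

  /-*-cancel : ∀ x {y} → 0# < y → x / y * y ≈ x
  /-*-cancel x {y} 0<y = begin-equality
    x * y ⁻¹ * y   ≈⟨ *-assoc _ _ _ ⟩
    x * (y ⁻¹ * y) ≈⟨ *-congˡ (*-inverseˡ 0<y) ⟩
    x * 1#         ≈⟨ *-identityʳ x ⟩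
    x              ∎

  *-cancelʳ-≤ : ∀ {c x y} → 0# < c → x * c ≤ y * c → x ≤ y
  *-cancelʳ-≤ {c} {x} {y} 0<c h = begin
    x               ≈⟨ inverse x ⟨
    x * c * c ⁻¹    ≤⟨ *-monoʳ-≤ (⁻¹-nonNegative 0<c) h ⟩
    y * c * c ⁻¹    ≈⟨ inverse y ⟩
    y               ∎
    where
    inverse : ∀ z → z * c * c ⁻¹ ≈ z
    inverse z = trans (*-assoc _ _ _) (trans (*-congˡ (*-inverseʳ (positive⇒≉0 0<c))) (*-identityʳ z))

  *-cancelʳ-≈ : ∀ {c x y} → 0# < c → x * c ≈ y * c → x ≈ y
  *-cancelʳ-≈ 0<c h = antisym (*-cancelʳ-≤ 0<c (≤-reflexive h)) (*-cancelʳ-≤ 0<c (≤-reflexive (sym h)))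

  /-unique : ∀ {x y z} → 0# < y → z * y ≈ x → z ≈ x / y
  /-unique {x} 0<y zy≈x = *-cancelʳ-≈ 0<y (trans zy≈x (sym (/-*-cancel x 0<y)))

  -- If y < x, then x x ≤ y y ≤ y x, and the positive factor x cancels. Absolute values are square
  -- roots, so they are compared through their squares.
  square-cancel-≤ : ∀ {x y} → 0# ≤ y → x * x ≤ y * y → x ≤ y
  square-cancel-≤ {x} {y} 0≤y h with x ≤? y
  ... | yes x≤y = x≤y
  ... | no x≰y = *-cancelʳ-≤ (≤-<-trans 0≤y y<x) (≤-trans h (*-monoˡ-≤ 0≤y (<⇒≤ y<x)))
    where
    y<x = ≰⇒> x≰y

  x<y⇒x-y<0 : ∀ {x y} → x < y → x - y < 0#
  x<y⇒x-y<0 {x} {y} (x≤y , x≉y) = ≤-trans (+-monoˡ-≤ (- y) x≤y) (≤-reflexive (-‿inverseʳ y)) , λ x-y≈0 → x≉y (begin-equality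
    x         ≈⟨ solve 2 (λ x y → x := (x :- y) :+ y) refl x y ⟩
    x - y + y ≈⟨ +-congʳ x-y≈0 ⟩
    0# + y    ≈⟨ +-identityˡ y ⟩
    y         ∎)

  neg-nonNegative : ∀ {a} → a ≤ 0# → 0# ≤ - a
  neg-nonNegative a≤0 = ≤-trans (x≤y⇒0≤y-x a≤0) (≤-reflexive (+-identityˡ _))

  x-y<z⇒x≤z+y : ∀ {x y z} → x - y < z → x ≤ z + y
  x-y<z⇒x≤z+y {x} {y} {z} h = begin
    x         ≈⟨ solve 2 (λ x y → x := (x :- y) :+ y) refl x y ⟩
    x - y + y ≤⟨ +-monoˡ-≤ y (<⇒≤ h) ⟩
    z + y     ∎

  fromℕ-mono : ∀ {m n} → m ℕ.≤ n → fromℕ m ≤ fromℕ n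
  fromℕ-mono {zero}  {zero}  _           = ≤-refl
  fromℕ-mono {zero}  {suc n} _           = +-nonNegative 0≤1 (fromℕ-mono (ℕ.z≤n {n}))
  fromℕ-mono {suc m} {suc n} (ℕ.s≤s m≤n) = +-monoʳ-≤ 1# (fromℕ-mono m≤n)

  fromℕ-1 : fromℕ 1 ≈ 1#
  fromℕ-1 = +-identityʳ 1#

  1≤fromℕ : ∀ {n} → 1 ℕ.≤ n → 1# ≤ fromℕ n
  1≤fromℕ 1≤n = ≤-trans (≤-reflexive (sym fromℕ-1)) (fromℕ-mono 1≤n)

  0<fromℕ : ∀ {n} → 1 ℕ.≤ n → 0# < fromℕ n
  0<fromℕ 1≤n = <-≤-trans 0<1 (1≤fromℕ 1≤n)

  fromℕ<suc : ∀ n → fromℕ n < fromℕ (suc n)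
  fromℕ<suc n = x≤y+x 0≤1 , λ n≈n+1 → 0≉1 (begin-equality
    0#                     ≈⟨ -‿inverseʳ (fromℕ n) ⟨
    fromℕ n - fromℕ n      ≈⟨ +-congʳ n≈n+1 ⟩
    1# + fromℕ n - fromℕ n ≈⟨ solve 1 (λ x → (𝟏 :+ x) :- x := 𝟏) refl (fromℕ n) ⟩
    1#                     ∎)

  1<2 : 1# < fromℕ 2
  1<2 = ≤-<-trans (≤-reflexive (sym fromℕ-1)) (fromℕ<suc 1)

  fromℕ-cancel-≤ : ∀ {m n} → fromℕ m ≤ fromℕ n → m ℕ.≤ n
  fromℕ-cancel-≤ {m} {n} h with m ℕ.≤? n
  ... | yes m≤n = m≤n
  ... | no m≰n = contradiction h (<⇒≱ (<-≤-trans (fromℕ<suc n) (fromℕ-mono (ℕ.≰⇒> m≰n))))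

  ^ⁿ-positive : ∀ {x} n → 0# < x → 0# < x ^ⁿ n
  ^ⁿ-positive zero    0<x = 0<1
  ^ⁿ-positive (suc n) 0<x = *-positive 0<x (^ⁿ-positive n 0<x)

  ^ⁿ-mono-≤ : ∀ {x y} n → 0# ≤ x → x ≤ y → x ^ⁿ n ≤ y ^ⁿ n
  ^ⁿ-mono-≤ zero    0≤x x≤y = ≤-refl
  ^ⁿ-mono-≤ {x} {y} (suc n) 0≤x x≤y =
    *-mono-≤ (≤-trans 0≤x x≤y) (^ⁿ-nonNegative n) x≤y (^ⁿ-mono-≤ n 0≤x x≤y)
    where
    ^ⁿ-nonNegative : ∀ n → 0# ≤ x ^ⁿ n
    ^ⁿ-nonNegative zero    = 0≤1
    ^ⁿ-nonNegative (suc n) = *-nonNegative 0≤x (^ⁿ-nonNegative n)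

  1^ⁿ : ∀ n → 1# ^ⁿ n ≈ 1#
  1^ⁿ zero = refl
  1^ⁿ (suc n) = trans (*-identityˡ _) (1^ⁿ n)

  ½ ¼ : ℝ
  ½ = 1# / fromℕ 2
  ¼ = ½ * ½

  ½+½≈1 : ½ + ½ ≈ 1#
  ½+½≈1 = begin-equality
    ½ + ½               ≈⟨ solve 1 (λ h → h :+ h := h :* (𝟏 :+ (𝟏 :+ 𝟎))) refl ½ ⟩
    ½ * fromℕ 2         ≈⟨ /-*-cancel 1# (0<fromℕ {2} (ℕ.s≤s ℕ.z≤n)) ⟩
    1#                  ∎

  ¼+¼≈½ : ¼ + ¼ ≈ ½
  ¼+¼≈½ = trans (sym (distribˡ ½ ½ ½)) (trans (*-congˡ ½+½≈1) (*-identityʳ ½))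

  4*¼≈1 : (¼ + ¼) + (¼ + ¼) ≈ 1#
  4*¼≈1 = trans (+-cong ¼+¼≈½ ¼+¼≈½) ½+½≈1

  0<½ : 0# < ½
  0<½ = *-positive 0<1 (⁻¹-positive (0<fromℕ {2} (ℕ.s≤s ℕ.z≤n)))

  0<¼ : 0# < ¼
  0<¼ = *-positive 0<½ 0<½

-- Laws of real powers.

module PowerLaws (R : CompleteOrderedField) (power : RealPower R) where
  open CompleteOrderedField R
  open RealPower power
  open OrderedField R
  open ≤R

  -- Serves for `x ^ 0#` and `1# ^ a`, which the axioms do not evaluate: both are positive and equal
  -- to their own squares.
  idempotent⇒1 : ∀ {x} → 0# < x → x * x ≈ x → x ≈ 1#
  idempotent⇒1 0<x xx≈x = *-cancelʳ-≈ 0<x (trans xx≈x (sym (*-identityˡ _)))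

  ^-congʳ : ∀ {x a b} → 0# < x → a ≈ b → x ^ a ≈ x ^ b
  ^-congʳ 0<x a≈b = ^-cong 0<x refl a≈b

  ^-zero : ∀ {x} → 0# < x → x ^ 0# ≈ 1#
  ^-zero 0<x = idempotent⇒1 (^-pos 0# 0<x)
    (trans (sym (^-+ 0# 0# 0<x)) (^-congʳ 0<x (+-identityˡ 0#)))

  1^ : ∀ a → 1# ^ a ≈ 1#
  1^ a = idempotent⇒1 (^-pos a 0<1)
    (trans (sym (^-* a 0<1 0<1)) (^-cong (*-positive 0<1 0<1) (*-identityˡ 1#) refl))

  ^-fromℕ* : ∀ {x} a n → 0# < x → x ^ (fromℕ n * a) ≈ (x ^ a) ^ⁿ n
  ^-fromℕ* a zero 0<x = trans (^-congʳ 0<x (zeroˡ a)) (^-zero 0<x)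
  ^-fromℕ* {x} a (suc n) 0<x = begin-equality
    x ^ ((1# + fromℕ n) * a)    ≈⟨ ^-congʳ 0<x (solve 2 (λ n a → (𝟏 :+ n) :* a := a :+ n :* a) refl (fromℕ n) a) ⟩
    x ^ (a + fromℕ n * a)       ≈⟨ ^-+ a (fromℕ n * a) 0<x ⟩
    x ^ a * x ^ (fromℕ n * a)   ≈⟨ *-congˡ (^-fromℕ* a n 0<x) ⟩
    x ^ a * (x ^ a) ^ⁿ n        ∎

  fromℕ-^ : ∀ p j a → 1 ℕ.≤ p → fromℕ (p ℕ.^ j) ^ a ≈ (fromℕ p ^ a) ^ⁿ j
  fromℕ-^ p zero a 1≤p = trans (^-cong (0<fromℕ {1} (ℕ.s≤s ℕ.z≤n)) fromℕ-1 refl) (1^ a)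
  fromℕ-^ p (suc j) a 1≤p = begin-equality
    fromℕ (p ℕ.* p ℕ.^ j) ^ a          ≈⟨ ^-cong (0<fromℕ (ℕ.*-mono-≤ 1≤p 1≤p^j)) (×1-homo-* p (p ℕ.^ j)) refl ⟩
    (fromℕ p * fromℕ (p ℕ.^ j)) ^ a    ≈⟨ ^-* a (0<fromℕ 1≤p) (0<fromℕ 1≤p^j) ⟩
    fromℕ p ^ a * fromℕ (p ℕ.^ j) ^ a  ≈⟨ *-congˡ (fromℕ-^ p j a 1≤p) ⟩
    fromℕ p ^ a * (fromℕ p ^ a) ^ⁿ j   ∎
    where
    1≤p^j : 1 ℕ.≤ p ℕ.^ j
    1≤p^j = ℕ.m^n>0 p {{ℕ.>-nonZero 1≤p}} j

  -- The axioms give monotonicity in the exponent only. With base y / x ≥ 1 it yields (y / x)^0 ≤ (y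
  -- / x)^a, and multiplying by x^a moves the comparison to the bases.
  ^-monoˡ-≤ : ∀ {x y a} → 0# ≤ a → 0# < x → x ≤ y → x ^ a ≤ y ^ a
  ^-monoˡ-≤ {x} {y} {a} 0≤a 0<x x≤y = begin
    x ^ a               ≈⟨ *-identityˡ _ ⟨
    1# * x ^ a          ≈⟨ *-congʳ (^-zero 0<y/x) ⟨
    (y / x) ^ 0# * x ^ a ≤⟨ *-monoʳ-≤ (<⇒≤ (^-pos a 0<x)) (^-monoʳ 1≤y/x 0≤a) ⟩
    (y / x) ^ a * x ^ a ≈⟨ ^-* a 0<y/x 0<x ⟨
    (y / x * x) ^ a     ≈⟨ ^-cong (*-positive 0<y/x 0<x) (/-*-cancel y 0<x) refl ⟩
    y ^ a               ∎
    where
    1≤y/x : 1# ≤ y / x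
    1≤y/x = *-cancelʳ-≤ 0<x (begin
      1# * x    ≈⟨ *-identityˡ x ⟩
      x         ≤⟨ x≤y ⟩
      y         ≈⟨ /-*-cancel y 0<x ⟨
      y / x * x ∎)
    0<y/x : 0# < y / x
    0<y/x = <-≤-trans 0<1 1≤y/x

  -- If x ^ a ≤ 1 then x ≤ x ^ (n a) = (x ^ a) ^ n ≤ 1 as soon as n a ≥ 1.
  1<^ : ∀ {x a} → 1# < x → 0# < a → 1# < x ^ a
  1<^ {x} {a} 1<x 0<a = ≰⇒> λ x^a≤1 → <⇒≱ 1<x (begin
    x                    ≈⟨ ^-1 0<x ⟨
    x ^ 1#               ≤⟨ ^-monoʳ (<⇒≤ 1<x) 1≤na ⟩
    x ^ (fromℕ n * a)    ≈⟨ ^-fromℕ* a n 0<x ⟩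
    (x ^ a) ^ⁿ n         ≤⟨ ^ⁿ-mono-≤ n (<⇒≤ (^-pos a 0<x)) x^a≤1 ⟩
    1# ^ⁿ n              ≈⟨ 1^ⁿ n ⟩
    1#                   ∎)
    where
    0<x = <-≤-trans 0<1 (<⇒≤ 1<x)
    n = proj₁ (archimedean (1# / a))
    1≤na : 1# ≤ fromℕ n * a
    1≤na = begin
      1#          ≈⟨ /-*-cancel 1# 0<a ⟨
      1# / a * a  ≤⟨ *-monoʳ-≤ (<⇒≤ 0<a) (proj₂ (archimedean (1# / a))) ⟩
      fromℕ n * a ∎

  x^a*x^-a≈1 : ∀ {x} a → 0# < x → x ^ a * x ^ (- a) ≈ 1#
  x^a*x^-a≈1 a 0<x = trans (sym (^-+ a (- a) 0<x)) (trans (^-congʳ 0<x (-‿inverseʳ a)) (^-zero 0<x))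

  ^-antitoneˡ : ∀ {x y a} → a ≤ 0# → 0# < x → x ≤ y → y ^ a ≤ x ^ a
  ^-antitoneˡ {x} {y} {a} a≤0 0<x x≤y = *-cancelʳ-≤ (^-pos (- a) 0<y) (begin
    y ^ a * y ^ (- a) ≈⟨ x^a*x^-a≈1 a 0<y ⟩
    1#                ≈⟨ x^a*x^-a≈1 a 0<x ⟨
    x ^ a * x ^ (- a) ≤⟨ *-monoˡ-≤ (<⇒≤ (^-pos a 0<x)) (^-monoˡ-≤ (neg-nonNegative a≤0) 0<x x≤y) ⟩
    x ^ a * y ^ (- a) ∎)
    where
    0<y = <-≤-trans 0<x x≤y

  ^<1 : ∀ {x a} → 1# < x → a < 0# → x ^ a < 1#
  ^<1 {x} {a} 1<x a<0 = ≰⇒> λ 1≤x^a → <⇒≱ (1<^ 1<x 0<-a) (begin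
    x ^ (- a)         ≈⟨ *-identityˡ _ ⟨
    1# * x ^ (- a)    ≤⟨ *-monoʳ-≤ (<⇒≤ (^-pos (- a) 0<x)) 1≤x^a ⟩
    x ^ a * x ^ (- a) ≈⟨ x^a*x^-a≈1 a 0<x ⟩
    1#                ∎)
    where
    0<x = <-≤-trans 0<1 (<⇒≤ 1<x)
    0<-a : 0# < - a
    0<-a = <-≤-trans (x<y⇒0<y-x a<0) (≤-reflexive (+-identityˡ _))

  ^ⁿ-neg-inverse : ∀ {x} a j → 0# < x → (x ^ (- a)) ^ⁿ j * (x ^ a) ^ⁿ j ≈ 1#
  ^ⁿ-neg-inverse {x} a j 0<x = begin-equality
    (x ^ (- a)) ^ⁿ j * (x ^ a) ^ⁿ j   ≈⟨ ^-distrib-* (x ^ (- a)) (x ^ a) j ⟨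
    (x ^ (- a) * x ^ a) ^ⁿ j          ≈⟨ ^-congˡ j (trans (*-comm _ _) (x^a*x^-a≈1 a 0<x)) ⟩
    1# ^ⁿ j                           ≈⟨ 1^ⁿ j ⟩
    1#                                ∎

  -- Links the quotients by p^(jσ) in the definitions of the series to natural powers of p^(-σ), for
  -- which splitting an exponent is plain ring arithmetic.
  x/^≈x*^- : ∀ {y} → 0# < y → ∀ x j a → x / y ^ (fromℕ j * a) ≈ x * (y ^ (- a)) ^ⁿ j
  x/^≈x*^- {y} 0<y x j a = sym (/-unique (^-pos _ 0<y) (begin-equality
    x * (y ^ (- a)) ^ⁿ j * y ^ (fromℕ j * a)      ≈⟨ *-congˡ (^-fromℕ* a j 0<y) ⟩
    x * (y ^ (- a)) ^ⁿ j * (y ^ a) ^ⁿ j           ≈⟨ *-assoc _ _ _ ⟩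
    x * ((y ^ (- a)) ^ⁿ j * (y ^ a) ^ⁿ j)         ≈⟨ *-congˡ (^ⁿ-neg-inverse a j 0<y) ⟩
    x * 1#                                        ≈⟨ *-identityʳ x ⟩
    x                                             ∎))

-- Complex numbers and their absolute value.

module ComplexNumbers (R : CompleteOrderedField) (power : RealPower R) where
  open Notions R power
  open OrderedField R
  open PowerLaws R power
  open ≤R

  -ᶜ_ : ℂ → ℂ
  -ᶜ (a +i b) = (- a) +i (- b)

  ℂ-commutativeRing : CommutativeRing 0ℓ 0ℓ
  ℂ-commutativeRing = record
    { Carrier = ℂ ; _≈_ = _≈ᶜ_ ; _+_ = _+ᶜ_ ; _*_ = _*ᶜ_ ; -_ = -ᶜ_ ; 0# = 0ᶜ ; 1# = 1ᶜ
    ; isCommutativeRing = record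
      { isRing = record
        { +-isAbelianGroup = record
          { isGroup = record
            { isMonoid = record
              { isSemigroup = record
                { isMagma = record
                  { isEquivalence = record
                    { refl = refl , refl
                    ; sym = λ (p , q) → sym p , sym q
                    ; trans = λ (p , q) (r , s) → trans p r , trans q s
                    }
                  ; ∙-cong = λ (p , q) (r , s) → +-cong p r , +-cong q s
                  }
                ; assoc = λ _ _ _ → +-assoc _ _ _ , +-assoc _ _ _
                }
              ; identity = (λ _ → +-identityˡ _ , +-identityˡ _) , (λ _ → +-identityʳ _ , +-identityʳ _)
              }
            ; inverse = (λ _ → -‿inverseˡ _ , -‿inverseˡ _) , (λ _ → -‿inverseʳ _ , -‿inverseʳ _)
            ; ⁻¹-cong = λ (p , q) → -‿cong p , -‿cong q
            }
          ; comm = λ _ _ → +-comm _ _ , +-comm _ _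
          }
        ; *-cong = λ (p , q) (r , s) →
            +-cong (*-cong p r) (-‿cong (*-cong q s)) , +-cong (*-cong p s) (*-cong q r)
        ; *-assoc = λ (a +i b) (c +i d) (e +i f) →
            solve 6 (λ a b c d e f → (a :* c :- b :* d) :* e :- (a :* d :+ b :* c) :* f
                                  := a :* (c :* e :- d :* f) :- b :* (c :* f :+ d :* e)) refl a b c d e f ,
            solve 6 (λ a b c d e f → (a :* c :- b :* d) :* f :+ (a :* d :+ b :* c) :* e
                                  := a :* (c :* f :+ d :* e) :+ b :* (c :* e :- d :* f)) refl a b c d e f
        ; *-identity = (λ z → trans (*ᶜ-comm₁ 1ᶜ z) (identity₁ z) , trans (*ᶜ-comm₂ 1ᶜ z) (identity₂ z)) ,
                       (λ z → identity₁ z , identity₂ z)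
        ; distrib = (λ x y z → distrib₁ x y z , distrib₂ x y z) ,
            (λ x y z → trans (*ᶜ-comm₁ (y +ᶜ z) x) (trans (distrib₁ x y z) (+-cong (*ᶜ-comm₁ x y) (*ᶜ-comm₁ x z))) ,
                       trans (*ᶜ-comm₂ (y +ᶜ z) x) (trans (distrib₂ x y z) (+-cong (*ᶜ-comm₂ x y) (*ᶜ-comm₂ x z))))
        }
      ; *-comm = λ z w → *ᶜ-comm₁ z w , *ᶜ-comm₂ z w
      }
    }
    where
    *ᶜ-comm₁ : ∀ z w → re (z *ᶜ w) ≈ re (w *ᶜ z)
    *ᶜ-comm₁ (a +i b) (c +i d) = solve 4 (λ a b c d → a :* c :- b :* d := c :* a :- d :* b) refl a b c d
    *ᶜ-comm₂ : ∀ z w → im (z *ᶜ w) ≈ im (w *ᶜ z)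
    *ᶜ-comm₂ (a +i b) (c +i d) = solve 4 (λ a b c d → a :* d :+ b :* c := c :* b :+ d :* a) refl a b c d
    identity₁ : ∀ z → re (z *ᶜ 1ᶜ) ≈ re z
    identity₁ (a +i b) = solve 2 (λ a b → a :* 𝟏 :- b :* 𝟎 := a) refl a b
    identity₂ : ∀ z → im (z *ᶜ 1ᶜ) ≈ im z
    identity₂ (a +i b) = solve 2 (λ a b → a :* 𝟎 :+ b :* 𝟏 := b) refl a b
    distrib₁ : ∀ x y z → re (x *ᶜ (y +ᶜ z)) ≈ re (x *ᶜ y +ᶜ x *ᶜ z)
    distrib₁ (a +i b) (c +i d) (e +i f) =
      solve 6 (λ a b c d e f → a :* (c :+ e) :- b :* (d :+ f) := (a :* c :- b :* d) :+ (a :* e :- b :* f)) refl a b c d e f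
    distrib₂ : ∀ x y z → im (x *ᶜ (y +ᶜ z)) ≈ im (x *ᶜ y +ᶜ x *ᶜ z)
    distrib₂ (a +i b) (c +i d) (e +i f) =
      solve 6 (λ a b c d e f → a :* (d :+ f) :+ b :* (c :+ e) := (a :* d :+ b :* c) :+ (a :* f :+ b :* e)) refl a b c d e f

  norm² : ℂ → ℝ
  norm² z = re z * re z + im z * im z

  0≤norm² : ∀ z → 0# ≤ norm² z
  0≤norm² z = +-nonNegative (0≤x*x _) (0≤x*x _)

  √-nonNegative : ∀ q → 0# ≤ √ q
  √-nonNegative q with q ≤? 0#
  ... | yes _   = ≤-refl
  ... | no q≰0  = <⇒≤ (^-pos _ (≰⇒> q≰0))

  √*√ : ∀ {q} → 0# ≤ q → √ q * √ q ≈ q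
  √*√ {q} 0≤q with q ≤? 0#
  ... | yes q≤0 = trans (zeroˡ 0#) (antisym 0≤q q≤0)
  ... | no q≰0 = begin-equality
    q ^ ½ * q ^ ½ ≈⟨ ^-+ ½ ½ 0<q ⟨
    q ^ (½ + ½)   ≈⟨ ^-congʳ 0<q ½+½≈1 ⟩
    q ^ 1#        ≈⟨ ^-1 0<q ⟩
    q             ∎
    where
    0<q = ≰⇒> q≰0

  0≤∣z∣ : ∀ z → 0# ≤ ∣ z ∣
  0≤∣z∣ z = √-nonNegative _

  ∣z∣*∣z∣ : ∀ z → ∣ z ∣ * ∣ z ∣ ≈ norm² z
  ∣z∣*∣z∣ z = √*√ (0≤norm² z)

  -- Reduces equations between absolute values to polynomial identities between squares, which the
  -- solver can check.
  ∣∣-unique : ∀ {x} z → 0# ≤ x → x * x ≈ norm² z → x ≈ ∣ z ∣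
  ∣∣-unique {x} z 0≤x h = antisym
    (square-cancel-≤ (0≤∣z∣ z) (≤-reflexive (trans h (sym (∣z∣*∣z∣ z)))))
    (square-cancel-≤ 0≤x (≤-reflexive (trans (∣z∣*∣z∣ z) (sym h))))

  ∣∣-cong : ∀ {z w} → z ≈ᶜ w → ∣ z ∣ ≈ ∣ w ∣
  ∣∣-cong {z} {w} (p , q) = ∣∣-unique w (0≤∣z∣ z) (trans (∣z∣*∣z∣ z) (+-cong (*-cong p p) (*-cong q q)))

  ∣0∣≈0 : ∣ 0ᶜ ∣ ≈ 0#
  ∣0∣≈0 = sym (∣∣-unique 0ᶜ ≤-refl (solve 0 (𝟎 :* 𝟎 := 𝟎 :* 𝟎 :+ 𝟎 :* 𝟎) refl))

  ∣1∣≈1 : ∣ 1ᶜ ∣ ≈ 1#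
  ∣1∣≈1 = sym (∣∣-unique 1ᶜ 0≤1 (solve 0 (𝟏 :* 𝟏 := 𝟏 :* 𝟏 :+ 𝟎 :* 𝟎) refl))

  ∣z-w∣≈∣w-z∣ : ∀ z w → ∣ z -ᶜ w ∣ ≈ ∣ w -ᶜ z ∣
  ∣z-w∣≈∣w-z∣ z@(a +i b) w@(c +i d) = ∣∣-unique (w -ᶜ z) (0≤∣z∣ _) (trans (∣z∣*∣z∣ (z -ᶜ w))
    (solve 4 (λ a b c d → (a :- c) :* (a :- c) :+ (b :- d) :* (b :- d) := (c :- a) :* (c :- a) :+ (d :- b) :* (d :- b)) refl a b c d))

  -- The two-square identity of Brahmagupta, followed by taking roots.
  ∣z*w∣ : ∀ z w → ∣ z *ᶜ w ∣ ≈ ∣ z ∣ * ∣ w ∣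
  ∣z*w∣ z@(a +i b) w@(c +i d) = sym (∣∣-unique (z *ᶜ w) (*-nonNegative (0≤∣z∣ z) (0≤∣z∣ w)) (begin-equality
    ∣ z ∣ * ∣ w ∣ * (∣ z ∣ * ∣ w ∣)       ≈⟨ solve 2 (λ x y → x :* y :* (x :* y) := x :* x :* (y :* y)) refl ∣ z ∣ ∣ w ∣ ⟩
    ∣ z ∣ * ∣ z ∣ * (∣ w ∣ * ∣ w ∣)       ≈⟨ *-cong (∣z∣*∣z∣ z) (∣z∣*∣z∣ w) ⟩
    norm² z * norm² w                     ≈⟨ solve 4 (λ a b c d → (a :* a :+ b :* b) :* (c :* c :+ d :* d)
       := (a :* c :- b :* d) :* (a :* c :- b :* d) :+ (a :* d :+ b :* c) :* (a :* d :+ b :* c)) refl a b c d ⟩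
    norm² (z *ᶜ w)                        ∎))

  -- Cauchy-Schwarz in the plane, from Lagrange's identity: the defect between the squares is (a d -
  -- b c)².
  re*re+im*im≤∣z∣*∣w∣ : ∀ z w → re z * re w + im z * im w ≤ ∣ z ∣ * ∣ w ∣
  re*re+im*im≤∣z∣*∣w∣ z@(a +i b) w@(c +i d) = square-cancel-≤ (*-nonNegative (0≤∣z∣ z) (0≤∣z∣ w)) (begin
    (a * c + b * d) * (a * c + b * d)                                         ≤⟨ x≤x+y (0≤x*x (a * d - b * c)) ⟩
    (a * c + b * d) * (a * c + b * d) + (a * d - b * c) * (a * d - b * c)
      ≈⟨ solve 4 (λ a b c d → (a :* c :+ b :* d) :* (a :* c :+ b :* d) :+ (a :* d :- b :* c) :* (a :* d :- b :* c)
           := (a :* a :+ b :* b) :* (c :* c :+ d :* d)) refl a b c d ⟩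
    norm² z * norm² w                   ≈⟨ *-cong (∣z∣*∣z∣ z) (∣z∣*∣z∣ w) ⟨
    ∣ z ∣ * ∣ z ∣ * (∣ w ∣ * ∣ w ∣)     ≈⟨ solve 2 (λ x y → x :* x :* (y :* y) := x :* y :* (x :* y)) refl ∣ z ∣ ∣ w ∣ ⟩
    ∣ z ∣ * ∣ w ∣ * (∣ z ∣ * ∣ w ∣)     ∎)

  ∣z+w∣≤∣z∣+∣w∣ : ∀ z w → ∣ z +ᶜ w ∣ ≤ ∣ z ∣ + ∣ w ∣
  ∣z+w∣≤∣z∣+∣w∣ z@(a +i b) w@(c +i d) = square-cancel-≤ (+-nonNegative (0≤∣z∣ z) (0≤∣z∣ w)) (begin
    ∣ z +ᶜ w ∣ * ∣ z +ᶜ w ∣                             ≈⟨ ∣z∣*∣z∣ (z +ᶜ w) ⟩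
    norm² (z +ᶜ w)                                      ≈⟨ solve 4 (λ a b c d → (a :+ c) :* (a :+ c) :+ (b :+ d) :* (b :+ d)
       := (a :* a :+ b :* b) :+ (c :* c :+ d :* d) :+ ((a :* c :+ b :* d) :+ (a :* c :+ b :* d))) refl a b c d ⟩
    norm² z + norm² w + (a * c + b * d + (a * c + b * d)) ≤⟨ +-mono-≤
       (≤-reflexive (sym (+-cong (∣z∣*∣z∣ z) (∣z∣*∣z∣ w))))
       (+-mono-≤ (re*re+im*im≤∣z∣*∣w∣ z w) (re*re+im*im≤∣z∣*∣w∣ z w)) ⟩
    ∣ z ∣ * ∣ z ∣ + ∣ w ∣ * ∣ w ∣ + (∣ z ∣ * ∣ w ∣ + ∣ z ∣ * ∣ w ∣)
      ≈⟨ solve 2 (λ x y → x :* x :+ y :* y :+ (x :* y :+ x :* y) := (x :+ y) :* (x :+ y)) refl ∣ z ∣ ∣ w ∣ ⟩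
    (∣ z ∣ + ∣ w ∣) * (∣ z ∣ + ∣ w ∣)                   ∎)

  ∣z-w∣≤∣z∣+∣w∣ : ∀ z w → ∣ z -ᶜ w ∣ ≤ ∣ z ∣ + ∣ w ∣
  ∣z-w∣≤∣z∣+∣w∣ z@(a +i b) w@(c +i d) = begin
    ∣ z +ᶜ -ᶜ w ∣      ≤⟨ ∣z+w∣≤∣z∣+∣w∣ z (-ᶜ w) ⟩
    ∣ z ∣ + ∣ -ᶜ w ∣   ≈⟨ +-congˡ (∣∣-unique w (0≤∣z∣ _) (trans (∣z∣*∣z∣ (-ᶜ w))
       (solve 2 (λ c d → (:- c) :* (:- c) :+ (:- d) :* (:- d) := c :* c :+ d :* d) refl c d))) ⟩
    ∣ z ∣ + ∣ w ∣      ∎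

-- Divisibility by primes and prime powers.

module PrimePowers where
  open import Data.Nat.Divisibility using (_∣_; _∤_; divides; _∣?_; ∣⇒≤; ∣m+n∣m⇒∣n; ∣-trans; n∣m*n; m∣m*n; ∣m⇒∣m*n; ∣1⇒≡1)

  prime⇒≥1 : ∀ {p} → Prime p → 1 ℕ.≤ p
  prime⇒≥1 pr = ℕ.>-nonZero⁻¹ _ {{prime⇒nonZero pr}}

  prime⇒≥2 : ∀ {p} → Prime p → 2 ℕ.≤ p
  prime⇒≥2 pr = ℕ.nonTrivial⇒n>1 _ {{prime⇒nonTrivial pr}}

  prime^≥1 : ∀ {p} → Prime p → ∀ a → 1 ℕ.≤ p ℕ.^ a
  prime^≥1 {p} pr a = ℕ.m^n>0 p {{prime⇒nonZero pr}} a

  prime^-cancel-≤ : ∀ {p} → Prime p → ∀ a b → p ℕ.^ a ℕ.≤ p ℕ.^ b → a ℕ.≤ b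
  prime^-cancel-≤ {p} pr a b h with a ℕ.≤? b
  ... | yes a≤b = a≤b
  ... | no a≰b = contradiction h (ℕ.<⇒≱ (ℕ.^-monoʳ-< p (prime⇒≥2 pr) (ℕ.≰⇒> a≰b)))

  n<prime^n : ∀ {p} → Prime p → ∀ n → n ℕ.< p ℕ.^ n
  n<prime^n pr zero = ℕ.s≤s ℕ.z≤n
  n<prime^n {p} pr (suc n) = ℕ.≤-trans (ℕ.s≤s (n<prime^n pr n)) (ℕ.^-monoʳ-< p (prime⇒≥2 pr) (ℕ.n<1+n n))

  prime∤⇒coprime : ∀ {p n} → Prime p → p ∤ n → Coprime p n
  prime∤⇒coprime pr p∤n (d∣p , d∣n) with prime⇒irreducible pr d∣p
  ... | inj₁ d≡1 = d≡1
  ... | inj₂ ≡.refl = contradiction d∣n p∤n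

  ∣-cancelʳ : ∀ {p} → Prime p → ∀ {e n} → e ℕ.* p ∣ p ℕ.* n → e ∣ n
  ∣-cancelʳ {p} pr {e} {n} (divides c eq) = divides c (ℕ.*-cancelˡ-≡ n (c ℕ.* e) p {{prime⇒nonZero pr}}
    (≡.trans eq (≡.trans (≡.sym (ℕ.*-assoc c e p)) (ℕ.*-comm (c ℕ.* e) p))))

  -- Induction on `a`: a divisor not divisible by p is coprime to p and already divides the smaller
  -- power, while otherwise one factor p cancels on both sides.
  ∣prime^⇒≡prime^ : ∀ {p} → Prime p → ∀ a {d} → d ∣ p ℕ.^ a → ∃ λ i → d ≡ p ℕ.^ i
  ∣prime^⇒≡prime^ pr zero d∣1 = 0 , ∣1⇒≡1 d∣1
  ∣prime^⇒≡prime^ {p} pr (suc a) {d} d∣p^ with p ∣? d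
  ... | no p∤d = ∣prime^⇒≡prime^ pr a (coprime-divisor (Coprime.sym (prime∤⇒coprime pr p∤d)) d∣p^)
  ... | yes (divides e ≡.refl)
    with i , e≡p^i ← ∣prime^⇒≡prime^ pr a {e} (∣-cancelʳ pr d∣p^)
    = suc i , ≡.trans (ℕ.*-comm e p) (≡.cong (p ℕ.*_) e≡p^i)

  prime^-coprime : ∀ {p n} → Prime p → p ∤ n → ∀ a → Coprime (p ℕ.^ a) n
  prime^-coprime {p} pr p∤n a (d∣p^a , d∣n) with ∣prime^⇒≡prime^ pr a d∣p^a
  ... | zero  , d≡1 = d≡1
  ... | suc i , ≡.refl = contradiction (∣-trans (m∣m*n (p ℕ.^ i)) d∣n) p∤n

  prime∣prime^⇒≡ : ∀ {p q} → Prime p → Prime q → ∀ a → p ∣ q ℕ.^ a → p ≡ q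
  prime∣prime^⇒≡ pr qr zero p∣1 = contradiction (≡.subst Prime (∣1⇒≡1 p∣1) pr) ¬prime[1]
  prime∣prime^⇒≡ {q = q} pr qr (suc a) p∣q^ with euclidsLemma q (q ℕ.^ a) pr p∣q^
  ... | inj₂ p∣q^a = prime∣prime^⇒≡ pr qr a p∣q^a
  ... | inj₁ p∣q with prime⇒irreducible qr p∣q
  ... | inj₁ ≡.refl = contradiction pr ¬prime[1]
  ... | inj₂ p≡q = p≡q

  primeDivisor : ∀ n → 2 ℕ.≤ n → ∃ λ p → Prime p × p ∣ n
  primeDivisor n@(suc (suc _)) 2≤n with factorise n
  ... | record { factors = [] ; isFactorisation = () }
  ... | record { factors = p ∷ ps ; isFactorisation = eq ; factorsPrime = pr ∷ _ } =
    p , pr , divides (product ps) (≡.trans eq (ℕ.*-comm p _))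
  primeDivisor (suc zero) (ℕ.s≤s ())

  primePart : ∀ {p} → Prime p → ∀ n → 1 ℕ.≤ n → ∃₂ λ a m → n ≡ p ℕ.^ a ℕ.* m × p ∤ m
  primePart {p} pr n = go n (<-wellFounded n)
    where
    go : ∀ n → Acc ℕ._<_ n → 1 ℕ.≤ n → ∃₂ λ a m → n ≡ p ℕ.^ a ℕ.* m × p ∤ m
    go n (acc rec) 1≤n with p ∣? n
    ... | no p∤n = 0 , n , ≡.sym (ℕ.*-identityˡ n) , p∤n
    ... | yes (divides zero ≡.refl) = contradiction 1≤n λ ()
    ... | yes (divides e@(suc _) ≡.refl)
      with a , m , e≡ , p∤m ← go e (rec (ℕ.m<m*n e p (prime⇒≥2 pr))) (ℕ.s≤s ℕ.z≤n)
      = suc a , m , ≡.trans (≡.cong (ℕ._* p) e≡) (≡.trans (ℕ.*-comm _ p) (≡.sym (ℕ.*-assoc p (p ℕ.^ a) m))) , p∤m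

open PrimePowers

-- Finite sums in a commutative ring, and sums over prime powers and multiples.

module FiniteSums (A : CommutativeRing 0ℓ 0ℓ) where
  open import Data.Nat.Divisibility using (_∣_; _∤_; divides; _∣?_; ∣⇒≤; ∣m+n∣m⇒∣n; ∣-trans; n∣m*n; m∣m*n; ∣m⇒∣m*n; ∣1⇒≡1)
  open CommutativeRing A
  open IntegerSolver A using (solve; _:=_; _:+_; _:*_)
  open Relation.Binary.Reasoning.Setoid setoid

  ∑ : ℕ → (ℕ → Carrier) → Carrier
  ∑ zero    a = 0#
  ∑ (suc n) a = ∑ n a + a n

  ∑-cong : ∀ n {a b} → (∀ i → i ℕ.< n → a i ≈ b i) → ∑ n a ≈ ∑ n b
  ∑-cong zero    h = refl
  ∑-cong (suc n) h = +-cong (∑-cong n λ i i<n → h i (ℕ.m<n⇒m<1+n i<n)) (h n (ℕ.n<1+n n))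

  ∑-zero : ∀ n {a} → (∀ i → i ℕ.< n → a i ≈ 0#) → ∑ n a ≈ 0#
  ∑-zero zero    h = refl
  ∑-zero (suc n) h = trans (+-cong (∑-zero n λ i i<n → h i (ℕ.m<n⇒m<1+n i<n)) (h n (ℕ.n<1+n n))) (+-identityˡ 0#)

  ∑-last : ∀ n {a} → (∀ i → i ℕ.< n → a i ≈ 0#) → ∑ (suc n) a ≈ a n
  ∑-last n h = trans (+-congʳ (∑-zero n h)) (+-identityˡ _)

  ∑-split : ∀ m n a → ∑ (m ℕ.+ n) a ≈ ∑ m a + ∑ n (λ i → a (m ℕ.+ i))
  ∑-split m zero    a = trans (reflexive (≡.cong (λ k → ∑ k a) (ℕ.+-identityʳ m))) (sym (+-identityʳ _))
  ∑-split m (suc n) a = begin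
    ∑ (m ℕ.+ suc n) a                                   ≡⟨ ≡.cong (λ k → ∑ k a) (ℕ.+-suc m n) ⟩
    ∑ (m ℕ.+ n) a + a (m ℕ.+ n)                         ≈⟨ +-congʳ (∑-split m n a) ⟩
    ∑ m a + ∑ n (λ i → a (m ℕ.+ i)) + a (m ℕ.+ n)       ≈⟨ +-assoc _ _ _ ⟩
    ∑ m a + ∑ (suc n) (λ i → a (m ℕ.+ i))               ∎

  ∑-head : ∀ n a → ∑ (suc n) a ≈ a 0 + ∑ n (a ∘ suc)
  ∑-head n a = trans (∑-split 1 n a) (+-congʳ (+-identityˡ (a 0)))

  ∑-truncate : ∀ m n {a} → m ℕ.≤ n → (∀ i → m ℕ.≤ i → i ℕ.< n → a i ≈ 0#) → ∑ n a ≈ ∑ m a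
  ∑-truncate m n {a} m≤n h = begin
    ∑ n a                                           ≡⟨ ≡.cong (λ k → ∑ k a) (ℕ.m+[n∸m]≡n m≤n) ⟨
    ∑ (m ℕ.+ (n ℕ.∸ m)) a                           ≈⟨ ∑-split m (n ℕ.∸ m) a ⟩
    ∑ m a + ∑ (n ℕ.∸ m) (λ i → a (m ℕ.+ i))         ≈⟨ +-congˡ (∑-zero (n ℕ.∸ m) λ i i< →
      h (m ℕ.+ i) (ℕ.m≤m+n m i) (ℕ.<-≤-trans (ℕ.+-monoʳ-< m i<) (ℕ.≤-reflexive (ℕ.m+[n∸m]≡n m≤n)))) ⟩
    ∑ m a + 0#                                      ≈⟨ +-identityʳ _ ⟩
    ∑ m a                                           ∎

  ∑-single : ∀ n k {a} → k ℕ.< n → (∀ i → i ≢ k → a i ≈ 0#) → ∑ n a ≈ a k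
  ∑-single n k k<n h = trans
    (∑-truncate (suc k) n k<n λ i k<i _ → h i λ i≡k → ℕ.<⇒≢ k<i (≡.sym i≡k))
    (∑-last k λ i i<k → h i (ℕ.<⇒≢ i<k))

  ∑-distrib-+ : ∀ n a b → ∑ n (λ i → a i + b i) ≈ ∑ n a + ∑ n b
  ∑-distrib-+ zero    a b = sym (+-identityˡ 0#)
  ∑-distrib-+ (suc n) a b = trans (+-congʳ (∑-distrib-+ n a b))
    (solve 4 (λ s t x y → s :+ t :+ (x :+ y) := s :+ x :+ (t :+ y)) refl (∑ n a) (∑ n b) (a n) (b n))

  *-distribˡ-∑ : ∀ n c a → c * ∑ n a ≈ ∑ n (λ i → c * a i)
  *-distribˡ-∑ zero    c a = zeroʳ c
  *-distribˡ-∑ (suc n) c a = trans (distribˡ c _ _) (+-congʳ (*-distribˡ-∑ n c a))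

  *-distribʳ-∑ : ∀ n c a → ∑ n a * c ≈ ∑ n (λ i → a i * c)
  *-distribʳ-∑ zero    c a = zeroˡ c
  *-distribʳ-∑ (suc n) c a = trans (distribʳ c _ _) (+-congʳ (*-distribʳ-∑ n c a))

  ∑-swap : ∀ m n (a : ℕ → ℕ → Carrier) → ∑ m (λ i → ∑ n (a i)) ≈ ∑ n (λ j → ∑ m (λ i → a i j))
  ∑-swap zero    n a = sym (∑-zero n λ _ _ → refl)
  ∑-swap (suc m) n a = trans (+-congʳ (∑-swap m n a)) (sym (∑-distrib-+ n _ _))

  ∑ᴸ : {X : Set} → List X → (X → Carrier) → Carrier
  ∑ᴸ xs a = foldr (λ x s → a x + s) 0# xs

  when : {P : Set} → Dec P → Carrier → Carrier
  when (yes _) x = x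
  when (no _)  x = 0#

  when-yes : {P : Set} (P? : Dec P) → P → ∀ x → when P? x ≈ x
  when-yes (yes _) p x = refl
  when-yes (no ¬p) p x = contradiction p ¬p

  when-no : {P : Set} (P? : Dec P) → ¬ P → ∀ x → when P? x ≈ 0#
  when-no (yes p) ¬p x = contradiction p ¬p
  when-no (no _)  ¬p x = refl

  when-cong : {P : Set} (P? : Dec P) → ∀ {x y} → x ≈ y → when P? x ≈ when P? y
  when-cong (yes _) h = h
  when-cong (no _)  h = refl

  ∑ᴸ-cong : {X : Set} (xs : List X) {a b : X → Carrier} → (∀ x → a x ≈ b x) → ∑ᴸ xs a ≈ ∑ᴸ xs b
  ∑ᴸ-cong []       h = refl
  ∑ᴸ-cong (x ∷ xs) h = +-cong (h x) (∑ᴸ-cong xs h)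

  ∑ᴸ-filter : {X : Set} {P : X → Set} (P? : Decidable P) (xs : List X) (a : X → Carrier) →
              ∑ᴸ (filter P? xs) a ≈ ∑ᴸ xs (λ x → when (P? x) (a x))
  ∑ᴸ-filter P? []       a = refl
  ∑ᴸ-filter P? (x ∷ xs) a with P? x
  ... | yes _ = +-congˡ (∑ᴸ-filter P? xs a)
  ... | no _  = trans (∑ᴸ-filter P? xs a) (sym (+-identityˡ _))

  ∑ᴸ-++ : {X : Set} (xs ys : List X) (a : X → Carrier) → ∑ᴸ (xs ++ ys) a ≈ ∑ᴸ xs a + ∑ᴸ ys a
  ∑ᴸ-++ []       ys a = sym (+-identityˡ _)
  ∑ᴸ-++ (x ∷ xs) ys a = trans (+-congˡ (∑ᴸ-++ xs ys a)) (sym (+-assoc _ _ _))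

  ∑ᴸ-map : {X Y : Set} (f : X → Y) (xs : List X) (a : Y → Carrier) → ∑ᴸ (map f xs) a ≈ ∑ᴸ xs (a ∘ f)
  ∑ᴸ-map f []       a = refl
  ∑ᴸ-map f (x ∷ xs) a = +-congˡ (∑ᴸ-map f xs a)

  ∑ᴸ-cartesianProduct : {X Y : Set} (xs : List X) (ys : List Y) (a : X × Y → Carrier) →
                        ∑ᴸ (cartesianProduct xs ys) a ≈ ∑ᴸ xs (λ x → ∑ᴸ ys (λ y → a (x , y)))
  ∑ᴸ-cartesianProduct []       ys a = refl
  ∑ᴸ-cartesianProduct (x ∷ xs) ys a = trans (∑ᴸ-++ (map (x ,_) ys) _ a)
    (+-cong (∑ᴸ-map (x ,_) ys a) (∑ᴸ-cartesianProduct xs ys a))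

  ∑ᴸ-applyUpTo : {X : Set} (f : ℕ → X) (n : ℕ) (a : X → Carrier) → ∑ᴸ (applyUpTo f n) a ≈ ∑ n (a ∘ f)
  ∑ᴸ-applyUpTo f zero    a = refl
  ∑ᴸ-applyUpTo f (suc n) a = trans (+-congˡ (∑ᴸ-applyUpTo (f ∘ suc) n a)) (sym (∑-head n (a ∘ f)))

  ∑ᴸ-[1‥] : ∀ n a → ∑ᴸ [1‥ n ] a ≈ ∑ n (a ∘ suc)
  ∑ᴸ-[1‥] n a = trans (reflexive (≡.cong (λ xs → ∑ᴸ xs a) (map-upTo suc n))) (∑ᴸ-applyUpTo suc n a)

  -- Induction on `a`: among the integers from p^a + 1 to p^(a+1) only the last is a power of p, so
  -- each such block contributes a single term.
  ∑-support-prime^ : ∀ {p} → Prime p → ∀ a (φ : ℕ → Carrier) →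
    (∀ d → (∀ i → d ≢ p ℕ.^ i) → φ d ≈ 0#) →
    ∑ (p ℕ.^ a) (φ ∘ suc) ≈ ∑ (suc a) (λ i → φ (p ℕ.^ i))
  ∑-support-prime^ pr zero φ h = refl
  ∑-support-prime^ {p} pr (suc a) φ h with ℕ.m≤n⇒∃[o]m+o≡n (ℕ.^-monoʳ-< p (prime⇒≥2 pr) (ℕ.n<1+n a))
  -- `c` counts the integers strictly between p^a and p^(a+1).
  ... | c , eq = begin
    ∑ (p ℕ.^ suc a) (φ ∘ suc)                   ≡⟨ ≡.cong (λ n → ∑ n (φ ∘ suc)) p^a+1+c ⟨
    ∑ (p ℕ.^ a ℕ.+ suc c) (φ ∘ suc)             ≈⟨ ∑-split (p ℕ.^ a) (suc c) (φ ∘ suc) ⟩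
    ∑ (p ℕ.^ a) (φ ∘ suc) + ∑ (suc c) (λ i → φ (suc (p ℕ.^ a ℕ.+ i)))
      ≈⟨ +-cong (∑-support-prime^ pr a φ h) (∑-last c λ i i<c → h _ (between i i<c)) ⟩
    ∑ (suc a) (λ i → φ (p ℕ.^ i)) + φ (suc (p ℕ.^ a ℕ.+ c)) ≡⟨ ≡.cong (λ n → ∑ (suc a) (λ i → φ (p ℕ.^ i)) + φ n) eq ⟩
    ∑ (suc (suc a)) (λ i → φ (p ℕ.^ i))         ∎
    where
    p^a+1+c : p ℕ.^ a ℕ.+ suc c ≡ p ℕ.^ suc a
    p^a+1+c = ≡.trans (ℕ.+-suc (p ℕ.^ a) c) eq
    between : ∀ i → i ℕ.< c → ∀ j → suc (p ℕ.^ a ℕ.+ i) ≢ p ℕ.^ j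
    between i i<c j d≡p^j with j ℕ.≤? a
    ... | yes j≤a = ℕ.<⇒≱ (ℕ.s≤s (ℕ.m≤m+n (p ℕ.^ a) i))
                      (≡.subst (ℕ._≤ p ℕ.^ a) (≡.sym d≡p^j) (ℕ.^-monoʳ-≤ p {{prime⇒nonZero pr}} j≤a))
    ... | no j≰a = ℕ.<⇒≱ (ℕ.+-monoʳ-< (suc (p ℕ.^ a)) i<c)
                      (≡.subst₂ ℕ._≤_ (≡.sym eq) (≡.sym d≡p^j) (ℕ.^-monoʳ-≤ p {{prime⇒nonZero pr}} (ℕ.≰⇒> j≰a)))

  infix 8 _⟨_/_⟩
  -- Extending F(n/d) by 0 to non-divisors turns sums over divisors or multiples into sums over full
  -- intervals, which can be exchanged and split freely.
  _⟨_/_⟩ : (ℕ → Carrier) → ℕ → ℕ → Carrier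
  F ⟨ n / d ⟩ with d ∣? n
  ... | yes (divides q _) = F q
  ... | no _              = 0#

  ⟨/⟩-multiple : ∀ F {n d} q → 1 ℕ.≤ d → n ≡ q ℕ.* d → F ⟨ n / d ⟩ ≈ F q
  ⟨/⟩-multiple F {n} {d} q 1≤d n≡qd with d ∣? n
  ... | yes (divides q′ n≡q′d) = reflexive (≡.cong F
          (ℕ.*-cancelʳ-≡ q′ q d {{ℕ.>-nonZero 1≤d}} (≡.trans (≡.sym n≡q′d) n≡qd)))
  ... | no d∤n = contradiction (divides q n≡qd) d∤n

  ⟨/⟩-∤ : ∀ F {n d} → d ∤ n → F ⟨ n / d ⟩ ≈ 0#
  ⟨/⟩-∤ F {n} {d} d∤n with d ∣? n
  ... | yes d∣n = contradiction d∣n d∤n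
  ... | no _ = refl

  private
    -- Each run of `d` integers following a multiple of `d` contains exactly one multiple, at its
    -- end.
    ∑-⟨/⟩-blocks : ∀ F d → 1 ℕ.≤ d → ∀ q → ∑ (q ℕ.* d) (λ i → F ⟨ suc i / d ⟩) ≈ ∑ q (F ∘ suc)
    ∑-⟨/⟩-blocks F d 1≤d zero = refl
    ∑-⟨/⟩-blocks F d@(suc d-1) 1≤d (suc q) = begin
      ∑ (d ℕ.+ q ℕ.* d) at                                        ≡⟨ ≡.cong (λ n → ∑ n at) (ℕ.+-comm d (q ℕ.* d)) ⟩
      ∑ (q ℕ.* d ℕ.+ d) at                                        ≈⟨ ∑-split (q ℕ.* d) d at ⟩
      ∑ (q ℕ.* d) at + ∑ d (λ i → at (q ℕ.* d ℕ.+ i))             ≈⟨ +-cong (∑-⟨/⟩-blocks F d 1≤d q) (∑-last d-1 λ i i<d-1 →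
         ⟨/⟩-∤ F λ d∣ → ℕ.<⇒≱ (ℕ.s≤s i<d-1) (∣⇒≤ (∣m+n∣m⇒∣n (≡.subst (d ∣_) (≡.sym (ℕ.+-suc (q ℕ.* d) i)) d∣) (n∣m*n q)))) ⟩
      ∑ q (F ∘ suc) + at (q ℕ.* d ℕ.+ d-1)                        ≈⟨ +-congˡ (⟨/⟩-multiple F (suc q) 1≤d
         (≡.cong suc (ℕ.+-comm (q ℕ.* d) d-1))) ⟩
      ∑ (suc q) (F ∘ suc)                                         ∎
      where
      at : ℕ → Carrier
      at i = F ⟨ suc i / d ⟩

  -- After q complete blocks of length `d` there remain `N % d` integers, which lie strictly between
  -- consecutive multiples of `d` and contribute nothing.
  ∑-⟨/⟩ : ∀ F N d .{{_ : ℕ.NonZero d}} → ∑ N (λ i → F ⟨ suc i / d ⟩) ≈ ∑ (N /ᴺ d) (F ∘ suc)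
  ∑-⟨/⟩ F N d = begin
    ∑ N at                                    ≡⟨ ≡.cong (λ n → ∑ n at) (≡.trans (m≡m%n+[m/n]*n N d) (ℕ.+-comm (N % d) (q ℕ.* d))) ⟩
    ∑ (q ℕ.* d ℕ.+ N % d) at                  ≈⟨ ∑-split (q ℕ.* d) (N % d) at ⟩
    ∑ (q ℕ.* d) at + ∑ (N % d) (λ i → at (q ℕ.* d ℕ.+ i))
      ≈⟨ +-cong (∑-⟨/⟩-blocks F d (ℕ.>-nonZero⁻¹ d) q) (∑-zero (N % d) λ i i<r →
         ⟨/⟩-∤ F λ d∣ → ℕ.<⇒≱ (ℕ.≤-<-trans i<r (m%n<n N d)) (∣⇒≤
           (∣m+n∣m⇒∣n (≡.subst (d ∣_) (≡.sym (ℕ.+-suc (q ℕ.* d) i)) d∣) (n∣m*n q)))) ⟩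
    ∑ q (F ∘ suc) + 0#                        ≈⟨ +-identityʳ _ ⟩
    ∑ q (F ∘ suc)                             ∎
    where
    q = N /ᴺ d
    at : ℕ → Carrier
    at i = F ⟨ suc i / d ⟩

-- Dirichlet convolution and its restriction to the powers of one prime.

module DirichletConvolution (A : CommutativeRing 0ℓ 0ℓ) where
  open import Data.Nat.Divisibility using (_∣_; _∤_; divides; _∣?_; ∣⇒≤; ∣m+n∣m⇒∣n; ∣-trans; n∣m*n; m∣m*n; ∣m⇒∣m*n; ∣1⇒≡1)
  open CommutativeRing A
  open IntegerSolver A using (solve; _:=_; _:+_; _:*_)
  open FiniteSums A
  open Relation.Binary.Reasoning.Setoid setoid

  -- The expression of `_⋆_` over an abstract ring. At `ℂ-commutativeRing` the two agree by
  -- definition, so a hypothesis on `f ⋆ h` can be passed here as it stands.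
  convolve : (ℕ → Carrier) → (ℕ → Carrier) → ℕ → Carrier
  convolve f h n =
    ∑ᴸ (filter (λ dm → proj₁ dm ℕ.* proj₂ dm ℕ.≟ n) (cartesianProduct [1‥ n ] [1‥ n ]))
       (λ dm → f (proj₁ dm) * h (proj₂ dm))

  -- For each m = j + 1 at most one d satisfies d m = n, so the inner sum over d has at most one
  -- nonzero term.
  convolve-⟨/⟩ : ∀ f h n → 1 ℕ.≤ n → convolve f h n ≈ ∑ n (λ j → h (suc j) * f ⟨ n / suc j ⟩)
  convolve-⟨/⟩ f h n 1≤n = begin
    convolve f h n
      ≈⟨ ∑ᴸ-filter (λ dm → proj₁ dm ℕ.* proj₂ dm ℕ.≟ n) (cartesianProduct [1‥ n ] [1‥ n ]) _ ⟩
    ∑ᴸ (cartesianProduct [1‥ n ] [1‥ n ]) (λ dm → term (proj₁ dm) (proj₂ dm))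
      ≈⟨ ∑ᴸ-cartesianProduct [1‥ n ] [1‥ n ] _ ⟩
    ∑ᴸ [1‥ n ] (λ d → ∑ᴸ [1‥ n ] (term d))
      ≈⟨ ∑ᴸ-cong [1‥ n ] (λ d → ∑ᴸ-[1‥] n (term d)) ⟩
    ∑ᴸ [1‥ n ] (λ d → ∑ n (λ j → term d (suc j)))
      ≈⟨ ∑ᴸ-[1‥] n _ ⟩
    ∑ n (λ i → ∑ n (λ j → term (suc i) (suc j)))
      ≈⟨ ∑-swap n n _ ⟩
    ∑ n (λ j → ∑ n (λ i → term (suc i) (suc j)))
      ≈⟨ ∑-cong n (λ j _ → inner j) ⟩
    ∑ n (λ j → h (suc j) * f ⟨ n / suc j ⟩) ∎
    where
    term : ℕ → ℕ → Carrier
    term d m = when (d ℕ.* m ℕ.≟ n) (f d * h m)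

    inner : ∀ j → ∑ n (λ i → term (suc i) (suc j)) ≈ h (suc j) * f ⟨ n / suc j ⟩
    inner j with suc j ∣? n
    ... | no j+1∤n = trans
      (∑-zero n λ i _ → when-no (suc i ℕ.* suc j ℕ.≟ n) (λ eq → j+1∤n (divides (suc i) (≡.sym eq))) _)
      (sym (zeroʳ _))
    ... | yes (divides zero n≡0) = contradiction (≡.subst (1 ℕ.≤_) n≡0 1≤n) λ ()
    ... | yes (divides (suc q) n≡) = begin
      ∑ n (λ i → term (suc i) (suc j))
        ≈⟨ ∑-single n q (≡.subst (suc q ℕ.≤_) (≡.sym n≡) (ℕ.m≤m*n (suc q) (suc j))) (λ i i≢q →
             when-no (suc i ℕ.* suc j ℕ.≟ n)
               (λ eq → i≢q (ℕ.suc-injective (ℕ.*-cancelʳ-≡ (suc i) (suc q) (suc j) (≡.trans eq n≡)))) _) ⟩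
      term (suc q) (suc j)    ≈⟨ when-yes (suc q ℕ.* suc j ℕ.≟ n) (≡.sym n≡) _ ⟩
      f (suc q) * h (suc j)   ≈⟨ *-comm _ _ ⟩
      h (suc j) * f (suc q)   ∎

  p^a≡p^[a∸j]*p^j : ∀ p {a j} → j ℕ.≤ a → p ℕ.^ a ≡ p ℕ.^ (a ℕ.∸ j) ℕ.* p ℕ.^ j
  p^a≡p^[a∸j]*p^j p {a} {j} j≤a =
    ≡.trans (≡.cong (p ℕ.^_) (≡.sym (ℕ.m∸n+n≡m j≤a))) (ℕ.^-distribˡ-+-* p (a ℕ.∸ j) j)

  convolve-prime^ : ∀ f h {p} → Prime p → ∀ a →
    convolve f h (p ℕ.^ a) ≈ ∑ (suc a) (λ j → h (p ℕ.^ j) * f (p ℕ.^ (a ℕ.∸ j)))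
  convolve-prime^ f h {p} pr a = begin
    convolve f h (p ℕ.^ a)
      ≈⟨ convolve-⟨/⟩ f h (p ℕ.^ a) (prime^≥1 pr a) ⟩
    ∑ (p ℕ.^ a) (λ j → h (suc j) * f ⟨ p ℕ.^ a / suc j ⟩)
      ≈⟨ ∑-support-prime^ pr a (λ d → h d * f ⟨ p ℕ.^ a / d ⟩) (λ d d≢p^ →
           trans (*-congˡ (⟨/⟩-∤ f λ d∣p^a → let i , d≡p^i = ∣prime^⇒≡prime^ pr a d∣p^a in d≢p^ i d≡p^i)) (zeroʳ _)) ⟩
    ∑ (suc a) (λ j → h (p ℕ.^ j) * f ⟨ p ℕ.^ a / p ℕ.^ j ⟩)
      ≈⟨ ∑-cong (suc a) (λ j j<a+1 → *-congˡ (⟨/⟩-multiple f (p ℕ.^ (a ℕ.∸ j)) (prime^≥1 pr j)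
           (p^a≡p^[a∸j]*p^j p (ℕ.≤-pred j<a+1)))) ⟩
    ∑ (suc a) (λ j → h (p ℕ.^ j) * f (p ℕ.^ (a ℕ.∸ j))) ∎

  -- Convolution with the part of h supported on powers of p.  Exponents are
  -- cut off at J, which is immaterial at arguments n ≤ J.
  twist : ℕ → (ℕ → Carrier) → ℕ → (ℕ → Carrier) → ℕ → Carrier
  twist J h p F n = ∑ (suc J) (λ j → h (p ℕ.^ j) * F ⟨ n / p ℕ.^ j ⟩)

  -- Once the two summations are exchanged, summing F(n / p^j) over n ≤ N gives the summatory
  -- function of F at N / p^j. This shorter range is what later produces the factor p^(-jσ).
  ∑-twist : ∀ J h {p} (pr : Prime p) F N →
    ∑ N (twist J h p F ∘ suc) ≈
    ∑ (suc J) (λ j → h (p ℕ.^ j) * ∑ ((N /ᴺ p ℕ.^ j) {{ℕ.m^n≢0 p j {{prime⇒nonZero pr}}}}) (F ∘ suc))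
  ∑-twist J h {p} pr F N = begin
    ∑ N (twist J h p F ∘ suc)
      ≈⟨ ∑-swap N (suc J) _ ⟩
    ∑ (suc J) (λ j → ∑ N (λ i → h (p ℕ.^ j) * F ⟨ suc i / p ℕ.^ j ⟩))
      ≈⟨ ∑-cong (suc J) (λ j _ → sym (*-distribˡ-∑ N (h (p ℕ.^ j)) _)) ⟩
    ∑ (suc J) (λ j → h (p ℕ.^ j) * ∑ N (λ i → F ⟨ suc i / p ℕ.^ j ⟩))
      ≈⟨ ∑-cong (suc J) (λ j _ → *-congˡ (∑-⟨/⟩ F N (p ℕ.^ j) {{ℕ.m^n≢0 p j {{prime⇒nonZero pr}}}})) ⟩
    ∑ (suc J) (λ j → h (p ℕ.^ j) * ∑ ((N /ᴺ p ℕ.^ j) {{ℕ.m^n≢0 p j {{prime⇒nonZero pr}}}}) (F ∘ suc)) ∎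

  -- Multiplicativity at the single prime `q`, with the local values prescribed by `c`. This is the
  -- property that can be followed through the stages, where `c` changes from f to g at one prime at
  -- a time. The bound on `a` reflects the cut-off in `twist`.
  FactorsAt : ℕ → (ℕ → Carrier) → ℕ → (ℕ → Carrier) → Set
  FactorsAt J F q c = ∀ a m → a ℕ.≤ J → 1 ℕ.≤ m → q ∤ m → F (q ℕ.^ a ℕ.* m) ≈ c (q ℕ.^ a) * F m

  module _ (J : ℕ) (h : ℕ → Carrier) (h1≈1 : h 1 ≈ 1#) {p : ℕ} (pr : Prime p) (F : ℕ → Carrier) where

    twist-∤ : ∀ {m} → p ∤ m → twist J h p F m ≈ F m
    twist-∤ {m} p∤m = begin
      twist J h p F m                   ≈⟨ ∑-single (suc J) 0 (ℕ.s≤s ℕ.z≤n) (λ j j≢0 →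
         trans (*-congˡ (⟨/⟩-∤ F λ p^j∣m → p∤m (∣-trans (p∣p^ j j≢0) p^j∣m))) (zeroʳ _)) ⟩
      h 1 * F ⟨ m / 1 ⟩                 ≈⟨ *-cong h1≈1 (⟨/⟩-multiple F m (ℕ.s≤s ℕ.z≤n) (≡.sym (ℕ.*-identityʳ m))) ⟩
      1# * F m                          ≈⟨ *-identityˡ _ ⟩
      F m                               ∎
      where
      p∣p^ : ∀ j → j ≢ 0 → p ∣ p ℕ.^ j
      p∣p^ zero    j≢0 = contradiction ≡.refl j≢0
      p∣p^ (suc j) _   = m∣m*n (p ℕ.^ j)

    -- In the sum at p^a m the terms with j > a vanish, since p^j does not divide p^a m. The others
    -- split off F m and leave the convolution identity for g(p^a); a ≤ J ensures that the cut-off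
    -- removes none of them.
    twist-factorsAt : ∀ {f g} → FactorsAt J F p f →
      (∀ a → g (p ℕ.^ a) ≈ ∑ (suc a) (λ j → h (p ℕ.^ j) * f (p ℕ.^ (a ℕ.∸ j)))) →
      FactorsAt J (twist J h p F) p g
    twist-factorsAt {f} {g} local g≈ a m a≤J 1≤m p∤m = begin
      twist J h p F (p ℕ.^ a ℕ.* m)
        ≈⟨ ∑-truncate (suc a) (suc J) (ℕ.s≤s a≤J) (λ j a<j _ →
             trans (*-congˡ (⟨/⟩-∤ F λ p^j∣ → ℕ.<⇒≱ a<j (j≤a p^j∣))) (zeroʳ _)) ⟩
      ∑ (suc a) (λ j → h (p ℕ.^ j) * F ⟨ p ℕ.^ a ℕ.* m / p ℕ.^ j ⟩)
        ≈⟨ ∑-cong (suc a) (λ j j<a+1 → let j≤a = ℕ.≤-pred j<a+1 in trans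
             (*-congˡ (trans (⟨/⟩-multiple F _ (prime^≥1 pr j) (quotient j≤a))
                             (local (a ℕ.∸ j) m (ℕ.≤-trans (ℕ.m∸n≤m a j) a≤J) 1≤m p∤m)))
             (sym (*-assoc _ _ _))) ⟩
      ∑ (suc a) (λ j → h (p ℕ.^ j) * f (p ℕ.^ (a ℕ.∸ j)) * F m)
        ≈⟨ *-distribʳ-∑ (suc a) (F m) _ ⟨
      ∑ (suc a) (λ j → h (p ℕ.^ j) * f (p ℕ.^ (a ℕ.∸ j))) * F m
        ≈⟨ *-cong (g≈ a) (twist-∤ p∤m) ⟨
      g (p ℕ.^ a) * twist J h p F m ∎
      where
      j≤a : ∀ {j} → p ℕ.^ j ∣ p ℕ.^ a ℕ.* m → j ℕ.≤ a
      j≤a {j} p^j∣ = prime^-cancel-≤ pr j a (∣⇒≤ {{ℕ.m^n≢0 p a {{prime⇒nonZero pr}}}}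
        (coprime-divisor (prime^-coprime pr p∤m j) (≡.subst (p ℕ.^ j ∣_) (ℕ.*-comm (p ℕ.^ a) m) p^j∣)))
      quotient : ∀ {j} → j ℕ.≤ a → p ℕ.^ a ℕ.* m ≡ (p ℕ.^ (a ℕ.∸ j) ℕ.* m) ℕ.* p ℕ.^ j
      quotient {j} j≤a = ≡.trans (≡.cong (ℕ._* m) (p^a≡p^[a∸j]*p^j p j≤a))
        (≡.trans (ℕ.*-assoc x y m) (≡.trans (≡.cong (x ℕ.*_) (ℕ.*-comm y m)) (≡.sym (ℕ.*-assoc x m y))))
        where
        x = p ℕ.^ (a ℕ.∸ j)
        y = p ℕ.^ j

    -- Powers of p are coprime to q^a, so p^j divides q^a m exactly when it divides m, and c(q^a)
    -- comes out of every term.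
    twist-factorsAt-≢ : ∀ {q} → Prime q → q ≢ p → ∀ {c} → FactorsAt J F q c → FactorsAt J (twist J h p F) q c
    twist-factorsAt-≢ {q} qr q≢p {c} local a m a≤J 1≤m q∤m = begin
      ∑ (suc J) (λ j → h (p ℕ.^ j) * F ⟨ q ℕ.^ a ℕ.* m / p ℕ.^ j ⟩)
        ≈⟨ ∑-cong (suc J) (λ j _ → trans (*-congˡ (term j))
             (solve 3 (λ x y z → x :* (y :* z) := y :* (x :* z)) refl _ _ _)) ⟩
      ∑ (suc J) (λ j → c (q ℕ.^ a) * (h (p ℕ.^ j) * F ⟨ m / p ℕ.^ j ⟩))
        ≈⟨ *-distribˡ-∑ (suc J) (c (q ℕ.^ a)) _ ⟨
      c (q ℕ.^ a) * twist J h p F m ∎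
      where
      p∤q^a : p ∤ q ℕ.^ a
      p∤q^a p∣q^a = q≢p (≡.sym (prime∣prime^⇒≡ pr qr a p∣q^a))
      term : ∀ j → F ⟨ q ℕ.^ a ℕ.* m / p ℕ.^ j ⟩ ≈ c (q ℕ.^ a) * F ⟨ m / p ℕ.^ j ⟩
      term j with p ℕ.^ j ∣? m
      ... | no p^j∤m = trans (⟨/⟩-∤ F λ p^j∣ → p^j∤m (coprime-divisor (prime^-coprime pr p∤q^a j) p^j∣)) (sym (zeroʳ _))
      ... | yes (divides t m≡) = trans
        (⟨/⟩-multiple F (q ℕ.^ a ℕ.* t) (prime^≥1 pr j) (≡.trans (≡.cong (q ℕ.^ a ℕ.*_) m≡) (≡.sym (ℕ.*-assoc (q ℕ.^ a) t (p ℕ.^ j)))))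
        (local a t a≤J (1≤t t m≡) λ q∣t → q∤m (≡.subst (q ∣_) (≡.sym m≡) (∣m⇒∣m*n (p ℕ.^ j) q∣t)))
        where
        1≤t : ∀ t → m ≡ t ℕ.* p ℕ.^ j → 1 ℕ.≤ t
        1≤t zero    m≡0 = contradiction (≡.subst (1 ℕ.≤_) m≡0 1≤m) λ ()
        1≤t (suc t) _   = ℕ.s≤s ℕ.z≤n

  MultiplicativeOn⁺ : (ℕ → Carrier) → Set
  MultiplicativeOn⁺ f = (f 1 ≈ 1#) ×
    (∀ m n → 1 ℕ.≤ m → 1 ℕ.≤ n → Coprime m n → f (m ℕ.* n) ≈ f m * f n)

  multiplicative⇒factorsAt : ∀ {f} → MultiplicativeOn⁺ f → ∀ J {q} → Prime q → FactorsAt J f q f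
  multiplicative⇒factorsAt (_ , mult) J {q} qr a m a≤J 1≤m q∤m =
    mult (q ℕ.^ a) m (prime^≥1 qr a) 1≤m (prime^-coprime qr q∤m a)

  -- Exchanging the values of `f` at prime powers for those of `g`, prime after prime.

  module PrimeByPrime (f g h : ℕ → Carrier) (f-mult : MultiplicativeOn⁺ f) (g-mult : MultiplicativeOn⁺ g)
                      (g≈f⋆h : ∀ n → 1 ℕ.≤ n → g n ≈ convolve f h n) where

    g-prime^ : ∀ {p} → Prime p → ∀ a → g (p ℕ.^ a) ≈ ∑ (suc a) (λ j → h (p ℕ.^ j) * f (p ℕ.^ (a ℕ.∸ j)))
    g-prime^ pr a = trans (g≈f⋆h _ (prime^≥1 pr a)) (convolve-prime^ f h pr a)

    h1≈1 : h 1 ≈ 1#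
    h1≈1 = begin
      h 1                             ≈⟨ *-identityʳ _ ⟨
      h 1 * 1#                        ≈⟨ *-congˡ (proj₁ f-mult) ⟨
      h 1 * f 1                       ≈⟨ *-congˡ (⟨/⟩-multiple f {1} 1 (ℕ.s≤s ℕ.z≤n) ≡.refl) ⟨
      h 1 * f ⟨ 1 / 1 ⟩               ≈⟨ +-identityˡ _ ⟨
      0# + h 1 * f ⟨ 1 / 1 ⟩          ≈⟨ convolve-⟨/⟩ f h 1 (ℕ.s≤s ℕ.z≤n) ⟨
      convolve f h 1                  ≈⟨ g≈f⋆h 1 (ℕ.s≤s ℕ.z≤n) ⟨
      g 1                             ≈⟨ proj₁ g-mult ⟩
      1#                              ∎

    -- The decision is an argument so that `stepAt-bound` can match on it directly.
    stepAt : ∀ {n} → Dec (Prime n) → ℕ → (ℕ → Carrier) → ℕ → Carrier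
    stepAt {n} (yes _) J F = twist J h n F
    stepAt     (no _)  J F = F

    -- For exponents up to `J`, the local values are those of g at the primes up to P and those of f
    -- at the primes beyond.
    stage : ℕ → ℕ → ℕ → Carrier
    stage J zero    = f
    stage J (suc P) = stepAt (prime? (suc P)) J (stage J P)

    stage-1 : ∀ J P → stage J P 1 ≈ 1#
    stage-1 J zero = proj₁ f-mult
    stage-1 J (suc P) with prime? (suc P)
    ... | no _   = stage-1 J P
    ... | yes pr = trans (twist-∤ J h h1≈1 pr (stage J P) λ p∣1 → ¬prime[1] (≡.subst Prime (∣1⇒≡1 p∣1) pr)) (stage-1 J P)

    stage-factorsAt-> : ∀ J P {q} → Prime q → P ℕ.< q → FactorsAt J (stage J P) q f
    stage-factorsAt-> J zero    qr _ = multiplicative⇒factorsAt f-mult J qr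
    stage-factorsAt-> J (suc P) {q} qr P+1<q with prime? (suc P)
    ... | no _   = stage-factorsAt-> J P qr (ℕ.<-trans (ℕ.n<1+n P) P+1<q)
    ... | yes pr = twist-factorsAt-≢ J h h1≈1 pr (stage J P) qr (λ q≡ → ℕ.<⇒≢ P+1<q (≡.sym q≡)) {f}
                     (stage-factorsAt-> J P qr (ℕ.<-trans (ℕ.n<1+n P) P+1<q))

    stage-factorsAt-≤ : ∀ J P {q} → Prime q → q ℕ.≤ P → FactorsAt J (stage J P) q g
    stage-factorsAt-≤ J zero    qr q≤0 = contradiction (ℕ.≤-trans (prime⇒≥1 qr) q≤0) λ ()
    stage-factorsAt-≤ J (suc P) {q} qr q≤P+1 with q ℕ.≟ suc P | prime? (suc P)
    ... | yes ≡.refl | no ¬pr = contradiction qr ¬pr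
    ... | yes ≡.refl | yes pr = twist-factorsAt J h h1≈1 pr (stage J P) {f} {g}
                                  (stage-factorsAt-> J P qr (ℕ.n<1+n P)) (g-prime^ pr)
    ... | no q≢      | no ¬pr = stage-factorsAt-≤ J P qr (ℕ.≤-pred (ℕ.≤∧≢⇒< q≤P+1 q≢))
    ... | no q≢      | yes pr = twist-factorsAt-≢ J h h1≈1 pr (stage J P) qr q≢ {g}
                                  (stage-factorsAt-≤ J P qr (ℕ.≤-pred (ℕ.≤∧≢⇒< q≤P+1 q≢)))

    -- Strong induction: split off the full power q^a of a prime divisor q of n. Here q ≤ n ≤ P, so
    -- q has been treated, and a < q^a ≤ n ≤ J keeps the exponent below the cut-off.
    stage≈g : ∀ J P n → 1 ℕ.≤ n → n ℕ.≤ J → n ℕ.≤ P → stage J P n ≈ g n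
    stage≈g J P n = go n (<-wellFounded n)
      where
      go : ∀ n → Acc ℕ._<_ n → 1 ℕ.≤ n → n ℕ.≤ J → n ℕ.≤ P → stage J P n ≈ g n
      go 1 _ _ _ _ = trans (stage-1 J P) (sym (proj₁ g-mult))
      go n@(suc (suc _)) (acc rec) 1≤n n≤J n≤P
        with q , qr , q∣n ← primeDivisor n (ℕ.s≤s (ℕ.s≤s ℕ.z≤n))
        with primePart qr n 1≤n
      ... | zero , m , n≡ , q∤m = contradiction (≡.subst (q ∣_) (≡.trans n≡ (ℕ.*-identityˡ m)) q∣n) q∤m
      ... | a@(suc a′) , zero , n≡ , q∤m = contradiction (≡.subst (1 ℕ.≤_) (≡.trans n≡ (ℕ.*-zeroʳ (q ℕ.^ a))) 1≤n) λ ()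
      ... | a@(suc a′) , m@(suc _) , n≡ , q∤m = begin
        stage J P n                    ≡⟨ ≡.cong (stage J P) n≡ ⟩
        stage J P (q ℕ.^ a ℕ.* m)      ≈⟨ stage-factorsAt-≤ J P qr (ℕ.≤-trans (∣⇒≤ q∣n) n≤P) a m a≤J (ℕ.s≤s ℕ.z≤n) q∤m ⟩
        g (q ℕ.^ a) * stage J P m      ≈⟨ *-congˡ (go m (rec m<n) (ℕ.s≤s ℕ.z≤n)
           (ℕ.≤-trans (ℕ.<⇒≤ m<n) n≤J) (ℕ.≤-trans (ℕ.<⇒≤ m<n) n≤P)) ⟩
        g (q ℕ.^ a) * g m              ≈⟨ multiplicative⇒factorsAt g-mult J qr a m a≤J (ℕ.s≤s ℕ.z≤n) q∤m ⟨
        g (q ℕ.^ a ℕ.* m)              ≡⟨ ≡.cong g n≡ ⟨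
        g n                            ∎
        where
        a≤J : a ℕ.≤ J
        a≤J = ℕ.≤-trans (ℕ.<⇒≤ (n<prime^n qr a)) (ℕ.≤-trans (ℕ.m≤m*n (q ℕ.^ a) m) (≡.subst (ℕ._≤ J) n≡ n≤J))
        m<n : m ℕ.< n
        m<n = ≡.subst (m ℕ.<_) (≡.trans (ℕ.*-comm m (q ℕ.^ a)) (≡.sym n≡))
          (ℕ.m<m*n m (q ℕ.^ a) (ℕ.≤-<-trans (ℕ.s≤s ℕ.z≤n) (n<prime^n qr a)))

-- Real estimates: geometric sums, condensation, a renewal inequality, products, tails of series.

module RealSums (R : CompleteOrderedField) (power : RealPower R) where
  open Notions R power
  open OrderedField R
  open PowerLaws R power
  open ComplexNumbers R power
  open ≤R
  open FiniteSums commutativeRing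
  module Σᶜ = FiniteSums ℂ-commutativeRing

  ∑-mono-≤ : ∀ n {a b} → (∀ i → i ℕ.< n → a i ≤ b i) → ∑ n a ≤ ∑ n b
  ∑-mono-≤ zero    h = ≤-refl
  ∑-mono-≤ (suc n) h = +-mono-≤ (∑-mono-≤ n λ i i<n → h i (ℕ.m<n⇒m<1+n i<n)) (h n (ℕ.n<1+n n))

  ∑-nonNegative : ∀ n {a} → (∀ i → 0# ≤ a i) → 0# ≤ ∑ n a
  ∑-nonNegative zero    h = ≤-refl
  ∑-nonNegative (suc n) h = +-nonNegative (∑-nonNegative n h) (h n)

  ∑-extend-≤ : ∀ m n {a} → (∀ i → 0# ≤ a i) → ∑ m a ≤ ∑ (m ℕ.+ n) a
  ∑-extend-≤ m n {a} h = begin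
    ∑ m a                                 ≤⟨ x≤x+y (∑-nonNegative n λ i → h (m ℕ.+ i)) ⟩
    ∑ m a + ∑ n (λ i → a (m ℕ.+ i))       ≈⟨ ∑-split m n a ⟨
    ∑ (m ℕ.+ n) a                         ∎

  ∑-extendˡ-≤ : ∀ m n {a} → (∀ i → 0# ≤ a i) → ∑ n a ≤ ∑ (m ℕ.+ n) a
  ∑-extendˡ-≤ m n {a} h =
    ≤-trans (∑-extend-≤ n m h) (≤-reflexive (reflexive (≡.cong (λ l → ∑ l a) (ℕ.+-comm n m))))

  ∣∑∣≤∑∣∣ : ∀ n (z : ℕ → ℂ) → ∣ Σᶜ.∑ n z ∣ ≤ ∑ n (λ i → ∣ z i ∣)
  ∣∑∣≤∑∣∣ zero    z = ≤-reflexive ∣0∣≈0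
  ∣∑∣≤∑∣∣ (suc n) z = ≤-trans (∣z+w∣≤∣z∣+∣w∣ _ _) (+-monoˡ-≤ _ (∣∑∣≤∑∣∣ n z))

  -- Telescoping; what is dropped is the positive remainder q^n. Keeping 1 - q as a factor avoids a
  -- division.
  geometric-≤ : ∀ {q} → 0# < q → ∀ n → (1# - q) * ∑ n (q ^ⁿ_) ≤ 1#
  geometric-≤ {q} 0<q n = begin
    (1# - q) * ∑ n (q ^ⁿ_)            ≤⟨ x≤x+y (<⇒≤ (^ⁿ-positive n 0<q)) ⟩
    (1# - q) * ∑ n (q ^ⁿ_) + q ^ⁿ n   ≈⟨ telescope n ⟩
    1#                                ∎
    where
    telescope : ∀ n → (1# - q) * ∑ n (q ^ⁿ_) + q ^ⁿ n ≈ 1#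
    telescope zero = solve 1 (λ q → (𝟏 :- q) :* 𝟎 :+ 𝟏 := 𝟏) refl q
    telescope (suc n) = trans
      (solve 3 (λ q s t → (𝟏 :- q) :* (s :+ t) :+ q :* t := (𝟏 :- q) :* s :+ t) refl q (∑ n (q ^ⁿ_)) (q ^ⁿ n))
      (telescope n)

  -- Comparing the terms 2n and 2n + 1 with twice the term 2n gives
  -- Z (2N + 1) ≤ 1 + r Z N for the partial sums Z, where r = 2 w 2.
  condensation-≤ : ∀ {w : ℕ → ℝ} → (∀ n → 0# ≤ w (suc n)) → w 1 ≈ 1# →
    (∀ n → w (suc (suc (suc n))) ≤ w (suc (suc n))) →
    (∀ n → w (2 ℕ.* suc n) ≈ w 2 * w (suc n)) →
    ∀ N → (1# - (w 2 + w 2)) * ∑ N (w ∘ suc) ≤ 1#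
  condensation-≤ {w} 0≤w w1≈1 antitone double N = begin
    (1# - r) * Z                  ≈⟨ solve 2 (λ r z → (𝟏 :- r) :* z := z :- r :* z) refl r Z ⟩
    Z - r * Z                     ≤⟨ +-monoˡ-≤ (- (r * Z)) (≤-trans Z≤ (doubling N)) ⟩
    1# + r * Z - r * Z            ≈⟨ solve 1 (λ x → (𝟏 :+ x) :- x := 𝟏) refl (r * Z) ⟩
    1#                            ∎
    where
    r = w 2 + w 2
    Z = ∑ N (w ∘ suc)
    Z≤ : Z ≤ ∑ (suc (N ℕ.+ N)) (w ∘ suc)
    Z≤ = ∑-extendˡ-≤ (suc N) N 0≤w

    doubling : ∀ N → ∑ (suc (N ℕ.+ N)) (w ∘ suc) ≤ 1# + r * ∑ N (w ∘ suc)
    doubling zero = ≤-reflexive (trans (+-identityˡ _) (trans w1≈1 (sym (trans (+-congˡ (zeroʳ r)) (+-identityʳ 1#)))))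
    doubling (suc N) = begin
      ∑ (suc (suc N ℕ.+ suc N)) (w ∘ suc)         ≡⟨ ≡.cong (λ n → ∑ (suc (suc n)) (w ∘ suc)) (ℕ.+-suc N N) ⟩
      ∑ (suc (N ℕ.+ N)) (w ∘ suc) + w (suc (suc (N ℕ.+ N))) + w (suc (suc (suc (N ℕ.+ N))))
                                                  ≤⟨ +-mono-≤ (+-monoˡ-≤ _ (doubling N)) (antitone (N ℕ.+ N)) ⟩
      1# + r * ∑ N (w ∘ suc) + w (suc (suc (N ℕ.+ N))) + w (suc (suc (N ℕ.+ N)))
                                                  ≈⟨ +-cong (+-congˡ even) even ⟩
      1# + r * ∑ N (w ∘ suc) + w 2 * w (suc N) + w 2 * w (suc N)
        ≈⟨ solve 3 (λ v s t → 𝟏 :+ (v :+ v) :* s :+ v :* t :+ v :* t := 𝟏 :+ (v :+ v) :* (s :+ t)) refl (w 2) _ _ ⟩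
      1# + r * ∑ (suc N) (w ∘ suc)                ∎
      where
      even : w (suc (suc (N ℕ.+ N))) ≈ w 2 * w (suc N)
      even = trans (reflexive (≡.cong w (≡.cong suc
        (≡.trans (≡.sym (ℕ.+-suc N N)) (≡.cong (λ n → N ℕ.+ suc n) (≡.sym (ℕ.+-identityʳ N)))))))
                   (double N)

  -- Horner form of the sum of q^(j-i) x_i over i < j. The one-step recursion is what makes the sum
  -- over j in `renewal-≤` tractable.
  geometricTail : ℝ → (ℕ → ℝ) → ℕ → ℝ
  geometricTail q x zero    = 0#
  geometricTail q x (suc j) = q * (geometricTail q x j + x j)

  ∑-geometricTail : ∀ q x j → ∑ j (λ i → q ^ⁿ (j ℕ.∸ i) * x i) ≈ geometricTail q x j
  ∑-geometricTail q x zero = refl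
  ∑-geometricTail q x (suc j) = begin-equality
    ∑ j (λ i → q ^ⁿ (suc j ℕ.∸ i) * x i) + q ^ⁿ (suc j ℕ.∸ j) * x j
      ≈⟨ +-cong (∑-cong j λ i i<j → trans (*-congʳ (reflexive (≡.cong (q ^ⁿ_) (ℕ.+-∸-assoc 1 (ℕ.<⇒≤ i<j))))) (*-assoc _ _ _))
                (*-congʳ (reflexive (≡.cong (q ^ⁿ_) (ℕ.m+n∸n≡m 1 j)))) ⟩
    ∑ j (λ i → q * (q ^ⁿ (j ℕ.∸ i) * x i)) + q ^ⁿ 1 * x j
      ≈⟨ +-cong (sym (*-distribˡ-∑ j q _)) (*-congʳ (*-identityʳ q)) ⟩
    q * ∑ j (λ i → q ^ⁿ (j ℕ.∸ i) * x i) + q * x j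
      ≈⟨ +-congʳ (*-congˡ (∑-geometricTail q x j)) ⟩
    q * geometricTail q x j + q * x j
      ≈⟨ distribˡ q _ _ ⟨
    q * (geometricTail q x j + x j) ∎

  -- Summing the inequality over j gives X ≤ D + ε Y, with Y the sum of the geometric tails. Their
  -- recursion gives Y ≤ q (Y + X), hence (1 - q) Y ≤ X. So 2 X ≤ 2 D + 2 ε Y ≤ 2 D + X, where the
  -- finite sum X cancels.
  renewal-≤ : ∀ {q ε} {x d : ℕ → ℝ} → 0# ≤ q → 0# ≤ ε → ε + ε ≤ 1# - q → (∀ j → 0# ≤ x j) →
    (∀ j → x j ≤ d j + ε * geometricTail q x j) → ∀ J → ∑ J x ≤ ∑ J d + ∑ J d
  renewal-≤ {q} {ε} {x} {d} 0≤q 0≤ε ε+ε≤1-q 0≤x x≤ J = +-cancelʳ-≤ X (begin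
    X + X                               ≤⟨ +-mono-≤ X≤D+εY X≤D+εY ⟩
    (D + ε * Y) + (D + ε * Y)           ≈⟨ solve 3 (λ d e y → (d :+ e :* y) :+ (d :+ e :* y) := (d :+ d) :+ (e :+ e) :* y) refl D ε Y ⟩
    (D + D) + (ε + ε) * Y               ≤⟨ +-monoʳ-≤ (D + D) (≤-trans (*-monoʳ-≤ 0≤Y ε+ε≤1-q) [1-q]Y≤X) ⟩
    (D + D) + X                         ∎)
    where
    y = geometricTail q x
    X = ∑ J x
    Y = ∑ J y
    D = ∑ J d
    0≤y : ∀ j → 0# ≤ y j
    0≤y zero    = ≤-refl
    0≤y (suc j) = *-nonNegative 0≤q (+-nonNegative (0≤y j) (0≤x j))
    0≤Y = ∑-nonNegative J 0≤y
    X≤D+εY : X ≤ D + ε * Y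
    X≤D+εY = begin
      X                                   ≤⟨ ∑-mono-≤ J (λ j _ → x≤ j) ⟩
      ∑ J (λ j → d j + ε * y j)           ≈⟨ ∑-distrib-+ J d _ ⟩
      D + ∑ J (λ j → ε * y j)             ≈⟨ +-congˡ (*-distribˡ-∑ J ε y) ⟨
      D + ε * Y                           ∎
    Y≤ : Y ≤ q * (Y + X)
    Y≤ = begin
      Y                                   ≤⟨ x≤x+y (0≤y J) ⟩
      ∑ (suc J) y                         ≈⟨ ∑-head J y ⟩
      0# + ∑ J (y ∘ suc)                  ≈⟨ +-identityˡ _ ⟩
      ∑ J (λ j → q * (y j + x j))         ≈⟨ *-distribˡ-∑ J q _ ⟨
      q * ∑ J (λ j → y j + x j)           ≈⟨ *-congˡ (∑-distrib-+ J y x) ⟩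
      q * (Y + X)                         ∎
    [1-q]Y≤X : (1# - q) * Y ≤ X
    [1-q]Y≤X = begin
      (1# - q) * Y                        ≈⟨ solve 2 (λ q y → (𝟏 :- q) :* y := y :- q :* y) refl q Y ⟩
      Y - q * Y                           ≤⟨ +-monoˡ-≤ (- (q * Y)) Y≤ ⟩
      q * (Y + X) - q * Y                 ≈⟨ solve 3 (λ q y x → q :* (y :+ x) :- q :* y := q :* x) refl q Y X ⟩
      -- Here q ≤ 1 follows from 0 ≤ ε + ε ≤ 1 - q.
      q * X                               ≤⟨ *-monoʳ-≤ (∑-nonNegative J 0≤x) (0≤y-x⇒x≤y (≤-trans (+-nonNegative 0≤ε 0≤ε) ε+ε≤1-q)) ⟩
      1# * X                              ≈⟨ *-identityˡ X ⟩
      X                                   ∎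

  ∏1+ : ℕ → (ℕ → ℝ) → ℝ
  ∏1+ zero    a = 1#
  ∏1+ (suc n) a = ∏1+ n a * (1# + a n)

  ∏1+-nonNegative : ∀ n {a} → (∀ i → 0# ≤ a i) → 0# ≤ ∏1+ n a
  ∏1+-nonNegative zero    0≤a = 0≤1
  ∏1+-nonNegative (suc n) 0≤a = *-nonNegative (∏1+-nonNegative n 0≤a) (+-nonNegative 0≤1 (0≤a n))

  -- One more factor does not increase the left side: (1 + x)(1 - (s + x)) = (1 - s) - (x x + s x).
  ∏1+*[1-∑]≤1 : ∀ n {a} → (∀ i → 0# ≤ a i) → ∏1+ n a * (1# - ∑ n a) ≤ 1#
  ∏1+*[1-∑]≤1 zero    0≤a = ≤-reflexive (solve 0 (𝟏 :* (𝟏 :- 𝟎) := 𝟏) refl)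
  ∏1+*[1-∑]≤1 (suc n) {a} 0≤a = begin
    Π * (1# + x) * (1# - (s + x))     ≤⟨ x≤x+y (*-nonNegative (∏1+-nonNegative n 0≤a)
           (+-nonNegative (*-nonNegative (0≤a n) (0≤a n)) (*-nonNegative (∑-nonNegative n 0≤a) (0≤a n)))) ⟩
    Π * (1# + x) * (1# - (s + x)) + Π * (x * x + s * x)
      ≈⟨ solve 3 (λ p x s → p :* (𝟏 :+ x) :* (𝟏 :- (s :+ x)) :+ p :* (x :* x :+ s :* x) := p :* (𝟏 :- s)) refl Π x s ⟩
    Π * (1# - s)                      ≤⟨ ∏1+*[1-∑]≤1 n 0≤a ⟩
    1#                                ∎
    where
    Π = ∏1+ n a
    x = a n
    s = ∑ n a

  -- Partial sums of nonnegative terms increase, so each is at most one whose index is so large that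
  -- it lies within 1 of the limit.
  converges⇒bounded : ∀ {u a} → (∀ i → 0# ≤ a i) → (∀ n → u n ≈ ∑ n a) → Converges u →
    ∃ λ B → (0# ≤ B) × (∀ n → ∑ n a ≤ B)
  converges⇒bounded {u} {a} 0≤a u≈ (L , conv) with conv 1# 0<1
  ... | N , near = 1# + L , bound 0 , bound
    where
    bound : ∀ n → ∑ n a ≤ 1# + L
    bound n = begin
      ∑ n a         ≤⟨ ∑-extendˡ-≤ N n 0≤a ⟩
      ∑ (N ℕ.+ n) a ≈⟨ u≈ (N ℕ.+ n) ⟨
      u (N ℕ.+ n)   ≤⟨ x-y<z⇒x≤z+y (proj₁ (near (N ℕ.+ n) (ℕ.m≤m+n N n))) ⟩
      1# + L        ∎

  converges⇒tails : ∀ {u a} → (∀ n → u n ≈ ∑ n a) → Converges u → ∀ ε → 0# < ε →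
    ∃ λ N → ∀ y → N ℕ.≤ y → ∀ n → ∑ n (λ i → a (y ℕ.+ i)) ≤ ε + ε
  converges⇒tails {u} {a} u≈ (L , conv) ε 0<ε with conv ε 0<ε
  ... | N , near = N , λ y N≤y n → begin
    ∑ n (λ i → a (y ℕ.+ i))                         ≈⟨ solve 2 (λ s t → t := (s :+ t) :- s) refl (∑ y a) _ ⟩
    ∑ y a + ∑ n (λ i → a (y ℕ.+ i)) - ∑ y a         ≈⟨ +-cong (trans (sym (∑-split y n a)) (sym (u≈ (y ℕ.+ n)))) (-‿cong (sym (u≈ y))) ⟩
    u (y ℕ.+ n) - u y                               ≈⟨ solve 3 (λ a b l → a :- b := (a :- l) :+ (l :- b)) refl _ _ L ⟩
    (u (y ℕ.+ n) - L) + (L - u y)                   ≤⟨ +-mono-≤ (<⇒≤ (proj₁ (near _ (ℕ.≤-trans N≤y (ℕ.m≤m+n y n))))) (<⇒≤ (proj₂ (near y N≤y))) ⟩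
    ε + ε                                           ∎

  private
    greatest : ∀ x → 0# ≤ x → ∀ M → ∃ λ N → (fromℕ N ≤ x) × (∀ n → n ℕ.≤ M → fromℕ n ≤ x → n ℕ.≤ N)
    greatest x 0≤x zero    = 0 , 0≤x , λ n n≤0 _ → n≤0
    greatest x 0≤x (suc M) with fromℕ (suc M) ≤? x
    ... | yes h = suc M , h , λ n n≤M+1 _ → n≤M+1
    ... | no ¬h with N , N≤x , max ← greatest x 0≤x M = N , N≤x , λ n n≤M+1 n≤x →
      max n (ℕ.≤-pred (ℕ.≤∧≢⇒< n≤M+1 λ { ≡.refl → ¬h n≤x })) n≤x

  floor : ∀ x → 0# ≤ x → ∃ λ N → (fromℕ N ≤ x) × (∀ n → fromℕ n ≤ x → n ℕ.≤ N)
  floor x 0≤x with M , x≤M ← archimedean x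
    with N , N≤x , max ← greatest x 0≤x M =
    N , N≤x , λ n n≤x → max n (fromℕ-cancel-≤ (≤-trans n≤x x≤M)) n≤x

  -- The list in `S` extends to an unspecified Archimedean bound; the indices beyond the integer
  -- part `N` of x are exactly those that its filter discards.
  S≈∑ : ∀ F {x N} → fromℕ N ≤ x → (∀ n → fromℕ n ≤ x → n ℕ.≤ N) → S F x ≈ᶜ Σᶜ.∑ N (F ∘ suc)
  S≈∑ F {x} {N} N≤x max = ℂR.trans (Σᶜ.∑ᴸ-filter (λ n → fromℕ n ≤? x) [1‥ M ] F)
    (ℂR.trans (Σᶜ.∑ᴸ-[1‥] M _)
    (ℂR.trans (Σᶜ.∑-truncate N M N≤M λ i N≤i _ → Σᶜ.when-no (fromℕ (suc i) ≤? x) (λ h → ℕ.<⇒≱ (ℕ.s≤s N≤i) (max (suc i) h)) _)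
             (Σᶜ.∑-cong N λ i i<N → Σᶜ.when-yes (fromℕ (suc i) ≤? x) (≤-trans (fromℕ-mono i<N) N≤x) _)))
    where
    module ℂR = CommutativeRing ℂ-commutativeRing
    M = proj₁ (archimedean x)
    N≤M : N ℕ.≤ M
    N≤M = fromℕ-cancel-≤ (≤-trans N≤x (proj₂ (archimedean x)))

-- Bounds for summatory functions and the cost of passing one prime.

module MeanValues (R : CompleteOrderedField) (power : RealPower R) where
  open Notions R power
  open OrderedField R
  open PowerLaws R power
  open ComplexNumbers R power
  open RealSums R power
  open FiniteSums commutativeRing
  open DirichletConvolution ℂ-commutativeRing
  open ≤R
  module ℂR = CommutativeRing ℂ-commutativeRing
  module ℂS = IntegerSolver ℂ-commutativeRing

  -- The constant is explicit because its growth from stage to stage is the quantity to be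
  -- controlled; `_≪[x^_]` would hide it.
  SummatoryBound : ℝ → Arithmetic → ℝ → Set
  SummatoryBound σ F K = ∀ N → 1 ℕ.≤ N → ∣ Σᶜ.∑ N (F ∘ suc) ∣ ≤ K * fromℕ N ^ σ

  SummatoryBound-mono : ∀ {σ F K L} → K ≤ L → SummatoryBound σ F K → SummatoryBound σ F L
  SummatoryBound-mono K≤L bound N 1≤N = ≤-trans (bound N 1≤N) (*-monoʳ-≤ (<⇒≤ (^-pos _ (0<fromℕ 1≤N))) K≤L)

  -- The index j belongs to the power p ^ (j + 1).
  weighted : ℝ → Arithmetic → ℕ → ℕ → ℝ
  weighted σ a p j = ∣ a (p ℕ.^ suc j) ∣ * (fromℕ p ^ (- σ)) ^ⁿ suc j

  weighted-nonNegative : ∀ σ a {p} → Prime p → ∀ j → 0# ≤ weighted σ a p j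
  weighted-nonNegative σ a pr j =
    *-nonNegative (0≤∣z∣ _) (<⇒≤ (^ⁿ-positive (suc j) (^-pos (- σ) (0<fromℕ (prime⇒≥1 pr)))))

  module _ {σ : ℝ} (0≤σ : 0# ≤ σ) where

    quotient-≤ : ∀ {F K} → 0# ≤ K → SummatoryBound σ F K → ∀ {p} → Prime p → ∀ j M N → 1 ℕ.≤ N →
      M ℕ.* p ℕ.^ j ℕ.≤ N → ∣ Σᶜ.∑ M (F ∘ suc) ∣ ≤ K * (fromℕ N ^ σ * (fromℕ p ^ (- σ)) ^ⁿ j)
    -- `SummatoryBound` says nothing at 0, where the sum is empty.
    quotient-≤ 0≤K bound {p} pr j zero N 1≤N _ = ≤-trans (≤-reflexive ∣0∣≈0)
      (*-nonNegative 0≤K (*-nonNegative (<⇒≤ (^-pos σ (0<fromℕ 1≤N)))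
        (<⇒≤ (^ⁿ-positive j (^-pos (- σ) (0<fromℕ (prime⇒≥1 pr)))))))
    quotient-≤ {F} {K} 0≤K bound {p} pr j M@(suc _) N 1≤N Md≤N = ≤-trans (bound M 1≤M)
      (*-monoˡ-≤ 0≤K (*-cancelʳ-≤ (^-pos σ 0<d) (begin
        fromℕ M ^ σ * d ^ σ                       ≈⟨ ^-* σ (0<fromℕ 1≤M) 0<d ⟨
        (fromℕ M * d) ^ σ                         ≈⟨ ^-cong 0<Md (×1-homo-* M (p ℕ.^ j)) refl ⟨
        fromℕ (M ℕ.* p ℕ.^ j) ^ σ                 ≤⟨ ^-monoˡ-≤ 0≤σ 0<Md (fromℕ-mono Md≤N) ⟩
        fromℕ N ^ σ                               ≈⟨ *-identityʳ _ ⟨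
        fromℕ N ^ σ * 1#                          ≈⟨ *-congˡ (^ⁿ-neg-inverse σ j 0<p) ⟨
        fromℕ N ^ σ * (t ^ⁿ j * (fromℕ p ^ σ) ^ⁿ j) ≈⟨ *-congˡ (*-congˡ (fromℕ-^ p j σ (prime⇒≥1 pr))) ⟨
        fromℕ N ^ σ * (t ^ⁿ j * d ^ σ)            ≈⟨ *-assoc _ _ _ ⟨
        fromℕ N ^ σ * t ^ⁿ j * d ^ σ              ∎)))
      where
      d = fromℕ (p ℕ.^ j)
      t = fromℕ p ^ (- σ)
      0<p = 0<fromℕ (prime⇒≥1 pr)
      0<d = 0<fromℕ (prime^≥1 pr j)
      1≤M : 1 ℕ.≤ M
      1≤M = ℕ.s≤s ℕ.z≤n
      0<Md : 0# < fromℕ (M ℕ.* p ℕ.^ j)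
      0<Md = 0<fromℕ (ℕ.*-mono-≤ 1≤M (prime^≥1 pr j))

    twist-bound : ∀ {F K E} J h {p} → Prime p → h 1 ≈ᶜ 1ᶜ → 0# ≤ K → SummatoryBound σ F K →
      ∑ J (weighted σ h p) ≤ E → SummatoryBound σ (twist J h p F) (K * (1# + E))
    twist-bound {F} {K} {E} J h {p} pr h1≈1 0≤K bound X≤E N 1≤N = begin
      ∣ Σᶜ.∑ N (twist J h p F ∘ suc) ∣
        ≈⟨ ∣∣-cong (∑-twist J h pr F N) ⟩
      ∣ Σᶜ.∑ (suc J) (λ j → h (p ℕ.^ j) *ᶜ Σᶜ.∑ (M j) (F ∘ suc)) ∣
        ≤⟨ ∣∑∣≤∑∣∣ (suc J) _ ⟩
      ∑ (suc J) (λ j → ∣ h (p ℕ.^ j) *ᶜ Σᶜ.∑ (M j) (F ∘ suc) ∣)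
        ≤⟨ ∑-mono-≤ (suc J) (λ j _ → term j) ⟩
      ∑ (suc J) (λ j → K * W * (∣ h (p ℕ.^ j) ∣ * t ^ⁿ j))
        ≈⟨ *-distribˡ-∑ (suc J) (K * W) _ ⟨
      K * W * ∑ (suc J) (λ j → ∣ h (p ℕ.^ j) ∣ * t ^ⁿ j)
        -- The term j = 0 is |h(1)| = 1.
        ≈⟨ *-congˡ (trans (∑-head J _) (+-congʳ (trans (*-identityʳ _) (trans (∣∣-cong h1≈1) ∣1∣≈1)))) ⟩
      K * W * (1# + ∑ J (weighted σ h p))
        ≤⟨ *-monoˡ-≤ (*-nonNegative 0≤K 0≤W) (+-monoʳ-≤ 1# X≤E) ⟩
      K * W * (1# + E)
        ≈⟨ solve 3 (λ k w e → k :* w :* e := k :* e :* w) refl K W (1# + E) ⟩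
      K * (1# + E) * W ∎
      where
      W = fromℕ N ^ σ
      t = fromℕ p ^ (- σ)
      0≤W = <⇒≤ (^-pos σ (0<fromℕ 1≤N))
      M : ℕ → ℕ
      M j = (N /ᴺ p ℕ.^ j) {{ℕ.m^n≢0 p j {{prime⇒nonZero pr}}}}
      term : ∀ j → ∣ h (p ℕ.^ j) *ᶜ Σᶜ.∑ (M j) (F ∘ suc) ∣ ≤ K * W * (∣ h (p ℕ.^ j) ∣ * t ^ⁿ j)
      term j = begin
        ∣ h (p ℕ.^ j) *ᶜ Σᶜ.∑ (M j) (F ∘ suc) ∣       ≈⟨ ∣z*w∣ _ _ ⟩
        ∣ h (p ℕ.^ j) ∣ * ∣ Σᶜ.∑ (M j) (F ∘ suc) ∣    ≤⟨ *-monoˡ-≤ (0≤∣z∣ _) (quotient-≤ {F} 0≤K bound pr j (M j) N 1≤N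
                                                           (m/n*n≤m N (p ℕ.^ j) {{ℕ.m^n≢0 p j {{prime⇒nonZero pr}}}})) ⟩
        ∣ h (p ℕ.^ j) ∣ * (K * (W * t ^ⁿ j))          ≈⟨ solve 4 (λ a k w t → a :* (k :* (w :* t)) := k :* w :* (a :* t)) refl _ K W _ ⟩
        K * W * (∣ h (p ℕ.^ j) ∣ * t ^ⁿ j)            ∎

  -- The local sums of `h` at a prime, and the growth of the bound over the stages.

  module StageBounds (f g h : Arithmetic) (f-mult : Multiplicative f) (g-mult : Multiplicative g) (g≈f⋆h : g ≗⁺ f ⋆ h) where
    open PrimeByPrime f g h f-mult g-mult g≈f⋆h

    f-g : Arithmetic
    f-g n = f n -ᶜ g n

    -- With n = j + 1, the end terms of the convolution at p^n are f(p^n) and h(p^n), so h(p^n)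
    -- equals g(p^n) - f(p^n) minus the inner terms h(p^(i+1)) f(p^m), m = j - i ≥ 1. There |f(p^m)|
    -- p^(-mσ) ≤ ε q^m with q = p^(δ-σ), which produces the geometric tail.
    weighted-renewal : ∀ {δ σ ε p} → Prime p → 0# ≤ ε → (∀ a → 1 ℕ.≤ a → ∣ f (p ℕ.^ a) ∣ ≤ ε * (fromℕ p ^ δ) ^ⁿ a) →
      ∀ j → weighted σ h p j ≤ weighted σ f-g p j + ε * geometricTail (fromℕ p ^ (δ - σ)) (weighted σ h p) j
    weighted-renewal {δ} {σ} {ε} {p} pr 0≤ε f≤ j = begin
      ∣ h (p ℕ.^ n) ∣ * t ^ⁿ n
        ≤⟨ *-monoʳ-≤ 0≤t^n (begin
             ∣ h (p ℕ.^ n) ∣                        ≈⟨ ∣∣-cong h≈ ⟩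
             ∣ (g (p ℕ.^ n) -ᶜ f (p ℕ.^ n)) -ᶜ Σ ∣  ≤⟨ ∣z-w∣≤∣z∣+∣w∣ _ _ ⟩
             ∣ g (p ℕ.^ n) -ᶜ f (p ℕ.^ n) ∣ + ∣ Σ ∣ ≤⟨ +-mono-≤ (≤-reflexive (∣z-w∣≈∣w-z∣ _ _)) (∣∑∣≤∑∣∣ j _) ⟩
             ∣ f-g (p ℕ.^ n) ∣ + ∑ j (λ i → ∣ φ i ∣) ∎) ⟩
      (∣ f-g (p ℕ.^ n) ∣ + ∑ j (λ i → ∣ φ i ∣)) * t ^ⁿ n
        ≈⟨ distribʳ _ _ _ ⟩
      weighted σ f-g p j + ∑ j (λ i → ∣ φ i ∣) * t ^ⁿ n
        ≈⟨ +-congˡ (*-distribʳ-∑ j (t ^ⁿ n) _) ⟩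
      weighted σ f-g p j + ∑ j (λ i → ∣ φ i ∣ * t ^ⁿ n)
        ≤⟨ +-monoʳ-≤ _ (∑-mono-≤ j λ i i<j → term i i<j) ⟩
      weighted σ f-g p j + ∑ j (λ i → ε * (q ^ⁿ (j ℕ.∸ i) * weighted σ h p i))
        ≈⟨ +-congˡ (trans (sym (*-distribˡ-∑ j ε _)) (*-congˡ (∑-geometricTail q (weighted σ h p) j))) ⟩
      weighted σ f-g p j + ε * geometricTail q (weighted σ h p) j ∎
      where
      n = suc j
      t = fromℕ p ^ (- σ)
      q = fromℕ p ^ (δ - σ)
      D = fromℕ p ^ δ
      0<p = 0<fromℕ (prime⇒≥1 pr)
      0≤t^ : ∀ i → 0# ≤ t ^ⁿ i
      0≤t^ i = <⇒≤ (^ⁿ-positive i (^-pos (- σ) 0<p))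
      0≤t^n = 0≤t^ n
      φ : ℕ → ℂ
      φ i = h (p ℕ.^ suc i) *ᶜ f (p ℕ.^ (j ℕ.∸ i))
      Σ = Σᶜ.∑ j φ
      g≈ : g (p ℕ.^ n) ≈ᶜ (f (p ℕ.^ n) +ᶜ Σ) +ᶜ h (p ℕ.^ n)
      g≈ = ℂR.trans (g-prime^ pr n) (ℂR.+-cong
        (ℂR.trans (Σᶜ.∑-head j _) (ℂR.+-cong (ℂR.trans (ℂR.*-cong h1≈1 ℂR.refl) (ℂR.*-identityˡ _)) ℂR.refl))
        (ℂR.trans (ℂR.*-cong ℂR.refl (ℂR.trans (ℂR.reflexive (≡.cong (λ i → f (p ℕ.^ i)) (ℕ.n∸n≡0 n))) (proj₁ f-mult))) (ℂR.*-identityʳ _)))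
      h≈ : h (p ℕ.^ n) ≈ᶜ (g (p ℕ.^ n) -ᶜ f (p ℕ.^ n)) -ᶜ Σ
      h≈ = ℂR.sym (ℂR.trans (ℂR.+-cong (ℂR.+-cong g≈ ℂR.refl) ℂR.refl)
        (ℂS.solve 3 (λ a s x → (((a ℂS.:+ s) ℂS.:+ x) ℂS.:- a) ℂS.:- s ℂS.:= x) ℂR.refl (f (p ℕ.^ n)) Σ (h (p ℕ.^ n))))
      q^≈ : ∀ i → D ^ⁿ i * t ^ⁿ i ≈ q ^ⁿ i
      q^≈ i = trans (sym (^-distrib-* D t i)) (^-congˡ i (sym (^-+ δ (- σ) 0<p)))
      term : ∀ i → i ℕ.< j → ∣ φ i ∣ * t ^ⁿ n ≤ ε * (q ^ⁿ (j ℕ.∸ i) * weighted σ h p i)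
      term i i<j = begin
        ∣ φ i ∣ * t ^ⁿ n                        ≈⟨ *-congʳ (∣z*w∣ _ _) ⟩
        x * ∣ f (p ℕ.^ m) ∣ * t ^ⁿ n            ≤⟨ *-monoʳ-≤ 0≤t^n (*-monoˡ-≤ (0≤∣z∣ _) (f≤ m (ℕ.m<n⇒0<n∸m i<j))) ⟩
        x * (ε * D ^ⁿ m) * t ^ⁿ n               ≈⟨ *-congˡ (trans (reflexive (≡.cong (t ^ⁿ_) n≡)) (^-homo-* t m (suc i))) ⟩
        x * (ε * D ^ⁿ m) * (t ^ⁿ m * t ^ⁿ suc i)
          ≈⟨ solve 5 (λ x e d t u → x :* (e :* d) :* (t :* u) := e :* ((d :* t) :* (x :* u))) refl x ε (D ^ⁿ m) (t ^ⁿ m) (t ^ⁿ suc i) ⟩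
        ε * ((D ^ⁿ m * t ^ⁿ m) * (x * t ^ⁿ suc i)) ≈⟨ *-congˡ (*-congʳ (q^≈ m)) ⟩
        ε * (q ^ⁿ m * weighted σ h p i)         ∎
        where
        x = ∣ h (p ℕ.^ suc i) ∣
        m = j ℕ.∸ i
        n≡ : n ≡ m ℕ.+ suc i
        n≡ = ≡.sym (≡.trans (ℕ.+-suc m i) (≡.cong suc (ℕ.m∸n+n≡m (ℕ.<⇒≤ i<j))))

    pretentiousTerm : ℝ → ℕ → ℕ → ℝ
    pretentiousTerm β k p = ∑ k (weighted β f-g p)

    -- `ρ` is a majorant of q = p^(δ-σ) that can be common to all primes, so that `ε` need not
    -- depend on p. Doubling by `renewal-≤` requires 2ε ≤ 1 - ρ. The differences f - g beyond
    -- exponent k then contribute at most 4 ε q^(k+1) G with a geometric sum G satisfying (1 - q) G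
    -- ≤ 1, whence the condition 4ε ≤ κ (1 - ρ).
    local-≤ : ∀ {β δ σ ε κ ρ p} k → Prime p → β ≤ σ → 0# ≤ ε → 0# ≤ κ →
      fromℕ p ^ (δ - σ) ≤ ρ → ε + ε ≤ 1# - ρ → (ε + ε) + (ε + ε) ≤ κ * (1# - ρ) →
      (∀ a → 1 ℕ.≤ a → ∣ f (p ℕ.^ a) ∣ ≤ ε * (fromℕ p ^ δ) ^ⁿ a) →
      (∀ a → 1 ℕ.≤ a → ∣ g (p ℕ.^ a) ∣ ≤ ε * (fromℕ p ^ δ) ^ⁿ a) →
      ∀ J → ∑ J (weighted σ h p) ≤ pretentiousTerm β k p + pretentiousTerm β k p + κ * (fromℕ p ^ (δ - σ)) ^ⁿ suc k
    local-≤ {β} {δ} {σ} {ε} {κ} {ρ} {p} k pr β≤σ 0≤ε 0≤κ q≤ρ 2ε≤1-ρ 4ε≤ f≤ g≤ J = begin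
      ∑ J (weighted σ h p)
        ≤⟨ renewal-≤ (<⇒≤ 0<q) 0≤ε (≤-trans 2ε≤1-ρ 1-ρ≤1-q) (weighted-nonNegative σ h pr)
             (weighted-renewal pr 0≤ε f≤) J ⟩
      D + D
        ≤⟨ +-mono-≤ D≤ D≤ ⟩
      (b + (ε + ε) * (q ^ⁿ suc k * G)) + (b + (ε + ε) * (q ^ⁿ suc k * G))
        ≈⟨ solve 4 (λ b e z s → (b :+ (e :+ e) :* (z :* s)) :+ (b :+ (e :+ e) :* (z :* s))
                             := (b :+ b) :+ ((e :+ e) :+ (e :+ e)) :* s :* z) refl b ε (q ^ⁿ suc k) G ⟩
      (b + b) + ((ε + ε) + (ε + ε)) * G * q ^ⁿ suc k
        ≤⟨ +-monoʳ-≤ (b + b) (*-monoʳ-≤ (<⇒≤ (^ⁿ-positive (suc k) 0<q)) 4εG≤κ) ⟩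
      (b + b) + κ * q ^ⁿ suc k ∎
      where
      0<p = 0<fromℕ (prime⇒≥1 pr)
      q = fromℕ p ^ (δ - σ)
      t = fromℕ p ^ (- σ)
      0<q = ^-pos (δ - σ) 0<p
      b = pretentiousTerm β k p
      D = ∑ J (weighted σ f-g p)
      G = ∑ J (q ^ⁿ_)
      0≤G : 0# ≤ G
      0≤G = ∑-nonNegative J λ i → <⇒≤ (^ⁿ-positive i 0<q)
      1-ρ≤1-q : 1# - ρ ≤ 1# - q
      1-ρ≤1-q = 0≤y-x⇒x≤y (≤-trans (x≤y⇒0≤y-x q≤ρ)
        (≤-reflexive (solve 2 (λ q r → r :- q := (𝟏 :- q) :- (𝟏 :- r)) refl q ρ)))
      4εG≤κ : ((ε + ε) + (ε + ε)) * G ≤ κ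
      4εG≤κ = begin
        ((ε + ε) + (ε + ε)) * G   ≤⟨ *-monoʳ-≤ 0≤G (≤-trans 4ε≤ (*-monoˡ-≤ 0≤κ 1-ρ≤1-q)) ⟩
        κ * (1# - q) * G          ≈⟨ *-assoc _ _ _ ⟩
        κ * ((1# - q) * G)        ≤⟨ *-monoˡ-≤ 0≤κ (geometric-≤ 0<q J) ⟩
        κ * 1#                    ≈⟨ *-identityʳ κ ⟩
        κ                         ∎
      near : ∀ j → weighted σ f-g p j ≤ weighted β f-g p j
      near j = *-monoˡ-≤ (0≤∣z∣ _) (^ⁿ-mono-≤ (suc j) (<⇒≤ (^-pos (- σ) 0<p)) (^-monoʳ (1≤fromℕ (prime⇒≥1 pr)) -σ≤-β))
        where
        -σ≤-β : - σ ≤ - β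
        -σ≤-β = 0≤y-x⇒x≤y (≤-trans (x≤y⇒0≤y-x β≤σ)
          (≤-reflexive (solve 2 (λ b s → s :- b := (:- b) :- (:- s)) refl β σ)))
      far : ∀ i → weighted σ f-g p (k ℕ.+ i) ≤ (ε + ε) * (q ^ⁿ suc k * q ^ⁿ i)
      far i = begin
        ∣ f-g (p ℕ.^ n) ∣ * t ^ⁿ n
          ≤⟨ *-monoʳ-≤ (<⇒≤ (^ⁿ-positive n (^-pos (- σ) 0<p))) (≤-trans (∣z-w∣≤∣z∣+∣w∣ _ _)
               (+-mono-≤ (f≤ n (ℕ.s≤s ℕ.z≤n)) (g≤ n (ℕ.s≤s ℕ.z≤n)))) ⟩
        (ε * P ^ⁿ n + ε * P ^ⁿ n) * t ^ⁿ n
          ≈⟨ solve 3 (λ e d t → (e :* d :+ e :* d) :* t := (e :+ e) :* (d :* t)) refl ε (P ^ⁿ n) (t ^ⁿ n) ⟩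
        (ε + ε) * (P ^ⁿ n * t ^ⁿ n)
          ≈⟨ *-congˡ (trans (sym (^-distrib-* P t n)) (trans (^-congˡ n (sym (^-+ δ (- σ) 0<p))) (^-homo-* q (suc k) i))) ⟩
        (ε + ε) * (q ^ⁿ suc k * q ^ⁿ i) ∎
        where
        n = suc (k ℕ.+ i)
        P = fromℕ p ^ δ
      D≤ : D ≤ b + (ε + ε) * (q ^ⁿ suc k * G)
      D≤ = begin
        D
          ≤⟨ ∑-extendˡ-≤ k J (weighted-nonNegative σ f-g pr) ⟩
        ∑ (k ℕ.+ J) (weighted σ f-g p)
          ≈⟨ ∑-split k J _ ⟩
        ∑ k (weighted σ f-g p) + ∑ J (λ i → weighted σ f-g p (k ℕ.+ i))
          ≤⟨ +-mono-≤ (∑-mono-≤ k λ j _ → near j) (∑-mono-≤ J λ i _ → far i) ⟩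
        b + ∑ J (λ i → (ε + ε) * (q ^ⁿ suc k * q ^ⁿ i))
          ≈⟨ +-congˡ (trans (*-congˡ (*-distribˡ-∑ J (q ^ⁿ suc k) _)) (*-distribˡ-∑ J (ε + ε) _)) ⟨
        b + (ε + ε) * (q ^ⁿ suc k * G) ∎

    stepAt-bound : ∀ {σ K A p} (p? : Dec (Prime p)) F → 0# ≤ σ → ∀ J → 0# ≤ K → 0# ≤ A →
      (Prime p → ∑ J (weighted σ h p) ≤ A) →
      SummatoryBound σ F K → SummatoryBound σ (stepAt p? J F) (K * (1# + A))
    stepAt-bound (yes pr) F 0≤σ J 0≤K 0≤A X≤A bound = twist-bound 0≤σ {F} J h pr h1≈1 0≤K bound (X≤A pr)
    stepAt-bound {K = K} {A} (no _) F 0≤σ J 0≤K 0≤A X≤A bound = SummatoryBound-mono {F = F} (begin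
      K               ≈⟨ *-identityʳ K ⟨
      K * 1#          ≤⟨ *-monoˡ-≤ 0≤K (x≤x+y 0≤A) ⟩
      K * (1# + A)    ∎) bound

    stage-bound : ∀ {σ K A} → 0# ≤ σ → ∀ J P → 0# ≤ K → 0# ≤ A →
      (Prime (suc P) → ∑ J (weighted σ h (suc P)) ≤ A) →
      SummatoryBound σ (stage J P) K → SummatoryBound σ (stage J (suc P)) (K * (1# + A))
    stage-bound 0≤σ J P = stepAt-bound (prime? (suc P)) (stage J P) 0≤σ J

    ∑-weighted : ∀ {σ p} → Prime p → ∀ n →
      sumℝ [1‥ n ] (λ j → ∣ h (p ℕ.^ j) ∣ / fromℕ p ^ (fromℕ j * σ)) ≈ ∑ n (weighted σ h p)
    ∑-weighted {σ} pr n = trans (∑ᴸ-[1‥] n _) (∑-cong n λ j _ → x/^≈x*^- (0<fromℕ (prime⇒≥1 pr)) _ (suc j) σ)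

    LocallyBounded : ℝ → ℕ → Set
    LocallyBounded σ p = ∃ λ A → (0# ≤ A) × (Prime p → ∀ J → ∑ J (weighted σ h p) ≤ A)

    ĤConvergent⇒locallyBounded : ∀ {σ} y → ĤConvergent h (fromℕ y) σ → ∀ {p} → p ℕ.≤ y → Dec (Prime p) → LocallyBounded σ p
    ĤConvergent⇒locallyBounded y Ĥ p≤y (no ¬pr) = 0# , ≤-refl , λ pr → contradiction pr ¬pr
    ĤConvergent⇒locallyBounded {σ} y Ĥ {p} p≤y (yes pr) =
      let A , 0≤A , X≤A = converges⇒bounded (weighted-nonNegative σ h pr) (∑-weighted pr) (Ĥ p pr (fromℕ-mono p≤y))
      in A , 0≤A , λ _ → X≤A

    -- `K` is quantified before `J`, because `J` will be the summation limit and the final constant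
    -- may not depend on it.
    UniformBound : ℝ → ℕ → Set
    UniformBound σ P = ∃ λ K → (0# ≤ K) × (∀ J → SummatoryBound σ (stage J P) K)

    earlyStages-bound : ∀ {σ K₀} → 0# ≤ σ → 0# ≤ K₀ → SummatoryBound σ f K₀ → ∀ y → ĤConvergent h (fromℕ y) σ →
      ∀ P → P ℕ.≤ y → UniformBound σ P
    earlyStages-bound {K₀ = K₀} 0≤σ 0≤K₀ bound y Ĥ zero _ = K₀ , 0≤K₀ , λ _ → bound
    earlyStages-bound {σ} 0≤σ 0≤K₀ bound y Ĥ (suc P) P<y =
      step (earlyStages-bound 0≤σ 0≤K₀ bound y Ĥ P (ℕ.<⇒≤ P<y)) (ĤConvergent⇒locallyBounded y Ĥ P<y (prime? (suc P)))
      where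
      step : UniformBound σ P → LocallyBounded σ (suc P) → UniformBound σ (suc P)
      step (K , 0≤K , stageBound) (A , 0≤A , X≤A) =
        K * (1# + A) , *-nonNegative 0≤K (+-nonNegative 0≤1 0≤A) ,
        λ J → stage-bound 0≤σ J P 0≤K 0≤A (λ pr → X≤A pr J) (stageBound J)

    -- The number `i` of these steps grows with the summation limit, so the constant is kept as a
    -- product that can afterwards be bounded independently of `i`.
    lateStages-bound : ∀ {σ K y} (a : ℕ → ℝ) → 0# ≤ σ → 0# ≤ K → (∀ i → 0# ≤ a i) →
      (∀ i → Prime (suc (y ℕ.+ i)) → ∀ J → ∑ J (weighted σ h (suc (y ℕ.+ i))) ≤ a i) →
      ∀ J → SummatoryBound σ (stage J y) K → ∀ i → SummatoryBound σ (stage J (y ℕ.+ i)) (K * ∏1+ i a)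
    lateStages-bound {σ} {K} {y} a 0≤σ 0≤K 0≤a X≤a J bound zero =
      ≡.subst (λ P → SummatoryBound σ (stage J P) (K * 1#)) (≡.sym (ℕ.+-identityʳ y))
        (SummatoryBound-mono {F = stage J y} (≤-reflexive (sym (*-identityʳ K))) bound)
    lateStages-bound {σ} {K} {y} a 0≤σ 0≤K 0≤a X≤a J bound (suc i) =
      ≡.subst (λ P → SummatoryBound σ (stage J P) (K * ∏1+ (suc i) a)) (≡.sym (ℕ.+-suc y i))
        (SummatoryBound-mono {F = stage J (suc (y ℕ.+ i))} (≤-reflexive (*-assoc _ _ _))
          (stage-bound 0≤σ J (y ℕ.+ i) (*-nonNegative 0≤K (∏1+-nonNegative i 0≤a)) (0≤a i) (λ pr → X≤a i pr J)
            (lateStages-bound a 0≤σ 0≤K 0≤a X≤a J bound i)))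

-- Return to `S`, the sum over large primes, and the choice of constants.

module Assembly (R : CompleteOrderedField) (power : RealPower R) where
  open Notions R power
  open OrderedField R
  open PowerLaws R power
  open ComplexNumbers R power
  open RealSums R power
  open FiniteSums commutativeRing
  open DirichletConvolution ℂ-commutativeRing
  open MeanValues R power
  open ≤R

  S≪⇒summatoryBound : ∀ {F α σ} → α ≤ σ → S F ≪[x^ α ] → ∃ λ C → (0# ≤ C) × SummatoryBound σ F C
  S≪⇒summatoryBound {F} {α} {σ} α≤σ (C , SF≤) = C , 0≤C , λ N 1≤N → begin
    ∣ Σᶜ.∑ N (F ∘ suc) ∣    ≈⟨ ∣∣-cong (S≈∑ F {N = N} ≤-refl (λ n → fromℕ-cancel-≤)) ⟨
    ∣ S F (fromℕ N) ∣       ≤⟨ SF≤ (fromℕ N) (1≤fromℕ 1≤N) ⟩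
    C * fromℕ N ^ α         ≤⟨ *-monoˡ-≤ 0≤C (^-monoʳ (1≤fromℕ 1≤N) α≤σ) ⟩
    C * fromℕ N ^ σ         ∎
    where
    -- The constant in `_≪[x^_]` comes without a sign; its value at x = 1 supplies one.
    0≤C : 0# ≤ C
    0≤C = begin
      0#          ≤⟨ 0≤∣z∣ _ ⟩
      ∣ S F 1# ∣  ≤⟨ SF≤ 1# ≤-refl ⟩
      C * 1# ^ α  ≈⟨ *-congˡ (1^ α) ⟩
      C * 1#      ≈⟨ *-identityʳ C ⟩
      C           ∎

  summatoryBound⇒S≪ : ∀ {F σ K} → 0# ≤ σ → 0# ≤ K → SummatoryBound σ F K → S F ≪[x^ σ ]
  summatoryBound⇒S≪ {F} {σ} {K} 0≤σ 0≤K bound = K , λ x 1≤x →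
    let N , N≤x , max = floor x (≤-trans 0≤1 1≤x)
        1≤N = max 1 (≤-trans (≤-reflexive fromℕ-1) 1≤x)
    in begin
    ∣ S F x ∣               ≈⟨ ∣∣-cong (S≈∑ F N≤x max) ⟩
    ∣ Σᶜ.∑ N (F ∘ suc) ∣    ≤⟨ bound N 1≤N ⟩
    K * fromℕ N ^ σ         ≤⟨ *-monoˡ-≤ 0≤K (^-monoˡ-≤ 0≤σ (0<fromℕ 1≤N) N≤x) ⟩
    K * x ^ σ               ∎

  module ZetaSum (ρ : ℝ) (ρ<0 : ρ < 0#) (m : ℕ) (1+mρ<0 : 1# + fromℕ m * ρ < 0#) where

    -- This is n^(mρ), in the shape in which `local-≤` leaves its error term when ρ = δ - σ and m =
    -- k + 1. Summing it over all integers majorises the sum over primes.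
    z : ℕ → ℝ
    z n = (fromℕ n ^ ρ) ^ⁿ m

    z-nonNegative : ∀ n → 0# ≤ z (suc n)
    z-nonNegative n = <⇒≤ (^ⁿ-positive m (^-pos ρ (0<fromℕ {suc n} (ℕ.s≤s ℕ.z≤n))))

    -- The left side is 2^(1+mρ), with negative exponent. It is the ratio r of the condensation
    -- argument.
    z2+z2<1 : z 2 + z 2 < 1#
    z2+z2<1 = ≤-<-trans (≤-reflexive (begin-equality
      z 2 + z 2                                   ≈⟨ solve 1 (λ x → x :+ x := (𝟏 :+ (𝟏 :+ 𝟎)) :* x) refl (z 2) ⟩
      fromℕ 2 * z 2                               ≈⟨ *-cong (^-1 0<2) (^-fromℕ* ρ m 0<2) ⟨
      fromℕ 2 ^ 1# * fromℕ 2 ^ (fromℕ m * ρ)      ≈⟨ ^-+ 1# (fromℕ m * ρ) 0<2 ⟨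
      fromℕ 2 ^ (1# + fromℕ m * ρ)                ∎)) (^<1 1<2 1+mρ<0)
      where
      0<2 = 0<fromℕ {2} (ℕ.s≤s ℕ.z≤n)

    z-sum-≤ : ∀ N → (1# - (z 2 + z 2)) * ∑ N (z ∘ suc) ≤ 1#
    z-sum-≤ = condensation-≤ {z} z-nonNegative z1≈1 antitone double
      where
      z1≈1 : z 1 ≈ 1#
      z1≈1 = trans (^-congˡ m (trans (^-cong (0<fromℕ {1} (ℕ.s≤s ℕ.z≤n)) fromℕ-1 refl) (1^ ρ))) (1^ⁿ m)
      antitone : ∀ n → z (suc (suc (suc n))) ≤ z (suc (suc n))
      antitone n = ^ⁿ-mono-≤ m (<⇒≤ (^-pos ρ (0<fromℕ {suc (suc (suc n))} (ℕ.s≤s ℕ.z≤n))))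
        (^-antitoneˡ (<⇒≤ ρ<0) (0<fromℕ {suc (suc n)} (ℕ.s≤s ℕ.z≤n)) (fromℕ-mono (ℕ.n≤1+n (suc (suc n)))))
      double : ∀ n → z (2 ℕ.* suc n) ≈ z 2 * z (suc n)
      double n = trans (^-congˡ m (trans
        (^-cong (0<fromℕ {2 ℕ.* suc n} (ℕ.s≤s ℕ.z≤n)) (×1-homo-* 2 (suc n)) refl)
        (^-* ρ (0<fromℕ {2} (ℕ.s≤s ℕ.z≤n)) (0<fromℕ {suc n} (ℕ.s≤s ℕ.z≤n)))))
        (^-distrib-* (fromℕ 2 ^ ρ) (fromℕ (suc n) ^ ρ) m)

  ∑≤½⇒∏1+≤2 : ∀ n {a} → (∀ i → 0# ≤ a i) → ∑ n a ≤ ½ → ∏1+ n a ≤ 1# + 1#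
  ∑≤½⇒∏1+≤2 n {a} 0≤a ∑≤½ = begin
    Π                 ≈⟨ *-identityʳ Π ⟨
    Π * 1#            ≈⟨ *-congˡ ½+½≈1 ⟨
    Π * (½ + ½)       ≈⟨ distribˡ Π ½ ½ ⟩
    Π * ½ + Π * ½     ≤⟨ +-mono-≤ Π*½≤1 Π*½≤1 ⟩
    1# + 1#           ∎
    where
    Π = ∏1+ n a
    ½≤1-∑ : ½ ≤ 1# - ∑ n a
    ½≤1-∑ = begin
      ½               ≈⟨ solve 1 (λ h → h := (h :+ h) :- h) refl ½ ⟩
      ½ + ½ - ½       ≈⟨ +-congʳ ½+½≈1 ⟩
      1# - ½          ≤⟨ 0≤y-x⇒x≤y (≤-trans (x≤y⇒0≤y-x ∑≤½)
         (≤-reflexive (solve 2 (λ h s → h :- s := (𝟏 :- s) :- (𝟏 :- h)) refl ½ (∑ n a)))) ⟩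
      1# - ∑ n a      ∎
    Π*½≤1 : Π * ½ ≤ 1#
    Π*½≤1 = ≤-trans (*-monoˡ-≤ (∏1+-nonNegative n 0≤a) ½≤1-∑) (∏1+*[1-∑]≤1 n 0≤a)

  -- A threshold passed by p is passed by every p^a with a ≥ 1, so one condition on p settles all
  -- its powers.
  o⇒prime^-≤ : ∀ {F : Arithmetic} {δ ε N p} → (∀ n → N ℕ.≤ n → ∣ F n ∣ ≤ ε * fromℕ n ^ δ) → 1 ℕ.≤ p → N ℕ.≤ p →
    ∀ a → 1 ℕ.≤ a → ∣ F (p ℕ.^ a) ∣ ≤ ε * (fromℕ p ^ δ) ^ⁿ a
  o⇒prime^-≤ {δ = δ} {p = p} F≤ 1≤p N≤p a@(suc b) 1≤a = ≤-trans
    (F≤ (p ℕ.^ a) (ℕ.≤-trans N≤p (ℕ.m≤m*n p (p ℕ.^ b) {{ℕ.m^n≢0 p b {{ℕ.>-nonZero 1≤p}}}})))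
    (≤-reflexive (*-congˡ (fromℕ-^ p a δ 1≤p)))

  -- Choice of the constants and proof of the bound for `S g`.

  module Theorem (f g h : Arithmetic) (f-mult : Multiplicative f) (g-mult : Multiplicative g) (g≈f⋆h : g ≗⁺ f ⋆ h)
                 (β δ σ : ℝ) (k : ℕ) (0<δ : 0# < δ) (1/[k+1]+δ<σ : 1# / fromℕ (suc k) + δ < σ) (β≤σ : β ≤ σ) where
    open PrimeByPrime f g h f-mult g-mult g≈f⋆h using (stage; stage≈g)
    open StageBounds f g h f-mult g-mult g≈f⋆h

    private
      m = suc k
      0<m = 0<fromℕ {m} (ℕ.s≤s ℕ.z≤n)
      0<1/m : 0# < 1# / fromℕ m
      0<1/m = *-positive 0<1 (⁻¹-positive 0<m)

    δ<σ : δ < σ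
    δ<σ = ≤-<-trans (x≤y+x (<⇒≤ 0<1/m)) 1/[k+1]+δ<σ

    0≤σ : 0# ≤ σ
    0≤σ = ≤-trans (<⇒≤ 0<δ) (<⇒≤ δ<σ)

    -- The hypothesis on σ multiplied by k + 1.
    1+m[δ-σ]<0 : 1# + fromℕ m * (δ - σ) < 0#
    1+m[δ-σ]<0 = ≤-<-trans (≤-reflexive (begin-equality
      1# + fromℕ m * (δ - σ)                        ≈⟨ +-congʳ (/-*-cancel 1# 0<m) ⟨
      1# / fromℕ m * fromℕ m + fromℕ m * (δ - σ)
        ≈⟨ solve 4 (λ x m d s → x :* m :+ m :* (d :- s) := 𝟎 :- m :* (s :- (x :+ d))) refl (1# / fromℕ m) (fromℕ m) δ σ ⟩
      0# - fromℕ m * (σ - (1# / fromℕ m + δ))       ∎))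
      (x<y⇒x-y<0 (*-positive 0<m (x<y⇒0<y-x 1/[k+1]+δ<σ)))

    open ZetaSum (δ - σ) (x<y⇒x-y<0 δ<σ) m 1+m[δ-σ]<0

    -- With 4ε = κ (1 - ρ₂) the bound of local-≤ has error term κ z p, and with
    -- 4κ = 1 - r these sum to at most ¼.  Tails of the pretentious sum count
    -- twice and are below 2τ, which contributes 4τ = ¼.
    r ρ₂ κ ε τ : ℝ
    r = z 2 + z 2
    ρ₂ = fromℕ 2 ^ (δ - σ)
    κ = (1# - r) * ¼
    ε = κ * (1# - ρ₂) * ¼
    τ = ¼ * ¼

    4*x¼≈x : ∀ x → (x * ¼ + x * ¼) + (x * ¼ + x * ¼) ≈ x
    4*x¼≈x x = trans (solve 2 (λ x q → (x :* q :+ x :* q) :+ (x :* q :+ x :* q) := x :* ((q :+ q) :+ (q :+ q))) refl x ¼)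
      (trans (*-congˡ 4*¼≈1) (*-identityʳ x))

    0<1-ρ₂ : 0# < 1# - ρ₂
    0<1-ρ₂ = x<y⇒0<y-x (^<1 1<2 (x<y⇒x-y<0 δ<σ))

    0<κ : 0# < κ
    0<κ = *-positive (x<y⇒0<y-x z2+z2<1) 0<¼

    0<ε : 0# < ε
    0<ε = *-positive (*-positive 0<κ 0<1-ρ₂) 0<¼

    0<τ : 0# < τ
    0<τ = *-positive 0<¼ 0<¼

    -- Turns the bound κ (1 - ρ₂) for 4ε into the bound 1 - ρ₂ for 2ε.
    κ≤1 : κ ≤ 1#
    κ≤1 = begin
      κ                   ≤⟨ x≤x+y (<⇒≤ 0<κ) ⟩
      κ + κ               ≤⟨ x≤x+y (+-nonNegative (<⇒≤ 0<κ) (<⇒≤ 0<κ)) ⟩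
      (κ + κ) + (κ + κ)   ≈⟨ 4*x¼≈x (1# - r) ⟩
      1# - r              ≤⟨ x≤x+y (+-nonNegative (z-nonNegative 1) (z-nonNegative 1)) ⟩
      1# - r + r          ≈⟨ solve 1 (λ r → (𝟏 :- r) :+ r := 𝟏) refl r ⟩
      1#                  ∎

    4ε≤ : (ε + ε) + (ε + ε) ≤ κ * (1# - ρ₂)
    4ε≤ = ≤-reflexive (4*x¼≈x _)

    2ε≤ : ε + ε ≤ 1# - ρ₂
    2ε≤ = begin
      ε + ε               ≤⟨ x≤x+y (+-nonNegative (<⇒≤ 0<ε) (<⇒≤ 0<ε)) ⟩
      (ε + ε) + (ε + ε)   ≤⟨ 4ε≤ ⟩
      κ * (1# - ρ₂)       ≤⟨ *-monoʳ-≤ (<⇒≤ 0<1-ρ₂) κ≤1 ⟩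
      1# * (1# - ρ₂)      ≈⟨ *-identityˡ _ ⟩
      1# - ρ₂             ∎

    b : ℕ → ℝ
    b = pretentiousTerm β k

    -- Extension by 0 to non-primes makes the pretentious distance a series over all integers, whose
    -- tails are sums over intervals.
    B : ℕ → ℝ
    B n = when (prime? n) (b n)

    ∑-pretentious : ∀ N → sumℝ (primesUpTo N) (λ p → sumℝ [1‥ k ] λ j →
        ∣ f (p ℕ.^ j) -ᶜ g (p ℕ.^ j) ∣ / fromℕ p ^ (fromℕ j * β)) ≈ ∑ N (B ∘ suc)
    ∑-pretentious N = trans (∑ᴸ-filter prime? [1‥ N ] _) (trans (∑ᴸ-[1‥] N _) (∑-cong N λ i _ →
      when-cong (prime? (suc i)) (trans (∑ᴸ-[1‥] k _) (∑-cong k λ j _ →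
        x/^≈x*^- (0<fromℕ {suc i} (ℕ.s≤s ℕ.z≤n)) _ (suc j) β))))

    B-nonNegative : ∀ n → 0# ≤ B n
    B-nonNegative n = nonNegative (prime? n)
      where
      nonNegative : (p? : Dec (Prime n)) → 0# ≤ when p? (b n)
      nonNegative (yes pr) = ∑-nonNegative k (weighted-nonNegative β f-g pr)
      nonNegative (no _)   = ≤-refl

    A : ℕ → ℝ
    A n = (B n + B n) + κ * z n

    A-nonNegative : ∀ n → 0# ≤ A (suc n)
    A-nonNegative n = +-nonNegative (+-nonNegative (B-nonNegative (suc n)) (B-nonNegative (suc n)))
      (*-nonNegative (<⇒≤ 0<κ) (z-nonNegative n))

    -- The three requirements on the cut-off. They do not mention h, so `y` can be chosen before the
    -- convergence of Ĥ is assumed.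
    module _ (y : ℕ)
             (tail-≤ : ∀ n → ∑ n (λ i → B (suc (y ℕ.+ i))) ≤ τ + τ)
             (f≤ : ∀ p → y ℕ.< p → ∀ a → 1 ℕ.≤ a → ∣ f (p ℕ.^ a) ∣ ≤ ε * (fromℕ p ^ δ) ^ⁿ a)
             (g≤ : ∀ p → y ℕ.< p → ∀ a → 1 ℕ.≤ a → ∣ g (p ℕ.^ a) ∣ ≤ ε * (fromℕ p ^ δ) ^ⁿ a) where

      ∑A≤½ : ∀ n → ∑ n (λ i → A (suc (y ℕ.+ i))) ≤ ½
      ∑A≤½ n = begin
        ∑ n (λ i → A (suc (y ℕ.+ i)))
          ≈⟨ trans (∑-distrib-+ n _ _) (+-cong (∑-distrib-+ n _ _) (sym (*-distribˡ-∑ n κ _))) ⟩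
        (T + T) + κ * ∑ n (λ i → z (suc (y ℕ.+ i)))
          -- For `B` smallness comes from the tail, for `z` from the factor `κ`; so the tail of `z`
          -- may be enlarged to the whole sum.
          ≤⟨ +-mono-≤ (+-mono-≤ (tail-≤ n) (tail-≤ n)) (*-monoˡ-≤ (<⇒≤ 0<κ) Z-tail-≤) ⟩
        ((τ + τ) + (τ + τ)) + κ * Z
          ≈⟨ +-cong (4*x¼≈x ¼) (solve 3 (λ c q z → c :* q :* z := c :* z :* q) refl (1# - r) ¼ Z) ⟩
        ¼ + (1# - r) * Z * ¼
          ≤⟨ +-monoʳ-≤ ¼ (*-monoʳ-≤ (<⇒≤ 0<¼) (z-sum-≤ (y ℕ.+ n))) ⟩
        ¼ + 1# * ¼
          ≈⟨ +-congˡ (*-identityˡ ¼) ⟩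
        ¼ + ¼
          ≈⟨ ¼+¼≈½ ⟩
        ½ ∎
        where
        T = ∑ n (λ i → B (suc (y ℕ.+ i)))
        Z = ∑ (y ℕ.+ n) (z ∘ suc)
        Z-tail-≤ : ∑ n (λ i → z (suc (y ℕ.+ i))) ≤ Z
        Z-tail-≤ = ≤-trans (x≤y+x (∑-nonNegative y z-nonNegative)) (≤-reflexive (sym (∑-split y n (z ∘ suc))))

      weighted-≤A : ∀ i → Prime (suc (y ℕ.+ i)) → ∀ J → ∑ J (weighted σ h (suc (y ℕ.+ i))) ≤ A (suc (y ℕ.+ i))
      weighted-≤A i pr J = ≤-trans
        (local-≤ {β} {δ} {σ} {ε} {κ} {ρ₂} k pr β≤σ (<⇒≤ 0<ε) (<⇒≤ 0<κ)
          -- The exponent δ - σ is negative and p ≥ 2, so `ρ₂` serves for all primes.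
          (^-antitoneˡ (<⇒≤ (x<y⇒x-y<0 δ<σ)) (0<fromℕ {2} (ℕ.s≤s ℕ.z≤n)) (fromℕ-mono (prime⇒≥2 pr)))
          2ε≤ 4ε≤ (f≤ p y<p) (g≤ p y<p) J)
        (≤-reflexive (+-congʳ (sym (+-cong (when-yes (prime? p) pr (b p)) (when-yes (prime? p) pr (b p))))))
        where
        p = suc (y ℕ.+ i)
        y<p : y ℕ.< p
        y<p = ℕ.s≤s (ℕ.m≤m+n y i)

      conclusion : ∀ {K₀} → 0# ≤ K₀ → SummatoryBound σ f K₀ → ĤConvergent h (fromℕ y) σ → S g ≪[x^ σ ]
      conclusion 0≤K₀ bound Ĥ =
        let K , 0≤K , stageBound = earlyStages-bound 0≤σ 0≤K₀ bound y Ĥ y ℕ.≤-refl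
        in summatoryBound⇒S≪ {g} 0≤σ (*-nonNegative 0≤K (+-nonNegative 0≤1 0≤1)) λ N 1≤N → begin
        ∣ Σᶜ.∑ N (g ∘ suc) ∣
          -- Cut-off J = N admits every argument up to N, and stage y + N has passed every prime up
          -- to N. Of its steps exactly N are late ones.
          ≈⟨ ∣∣-cong (Σᶜ.∑-cong N λ i i<N → stage≈g N (y ℕ.+ N) (suc i) (ℕ.s≤s ℕ.z≤n) i<N (ℕ.≤-trans i<N (ℕ.m≤n+m N y))) ⟨
        ∣ Σᶜ.∑ N (stage N (y ℕ.+ N) ∘ suc) ∣
          ≤⟨ lateStages-bound (λ i → A (suc (y ℕ.+ i))) 0≤σ 0≤K (λ i → A-nonNegative (y ℕ.+ i))
               weighted-≤A N (stageBound N) N N 1≤N ⟩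
        K * ∏1+ N (λ i → A (suc (y ℕ.+ i))) * fromℕ N ^ σ
          ≤⟨ *-monoʳ-≤ (<⇒≤ (^-pos σ (0<fromℕ 1≤N))) (*-monoˡ-≤ 0≤K
               (∑≤½⇒∏1+≤2 N (λ i → A-nonNegative (y ℕ.+ i)) (∑A≤½ N))) ⟩
        K * (1# + 1#) * fromℕ N ^ σ ∎

theorem3 : (R : CompleteOrderedField) (power : RealPower R) →
    let open Notions R power in
    (f g h : Arithmetic) (α β δ σ : ℝ) (k : ℕ) →
    Multiplicative f →
    Multiplicative g →
    S f ≪[x^ α ] →
    1 ℕ.≤ k →
    StronglyPretentious β k f g →
    0# < δ →
    f =o[n^ δ ] →
    g =o[n^ δ ] →
    g ≗⁺ f ⋆ h →
    1# / fromℕ (suc k) + δ < σ →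
    α ≤ σ →
    β ≤ σ →
    ∃ λ Y → (0# < Y) × (ĤConvergent h Y σ → S g ≪[x^ σ ])
theorem3 R power f g h α β δ σ k f-mult g-mult Sf≪ 1≤k pretentious 0<δ f=o g=o g≈f⋆h 1/[k+1]+δ<σ α≤σ β≤σ =
  fromℕ y , 0<fromℕ {y} (ℕ.s≤s ℕ.z≤n) ,
  conclusion y (tails y (ℕ.m≤n⇒m≤1+n (ℕ.m≤n+m Nτ (Nf ℕ.+ Ng))))
    (λ p y<p → o⇒prime^-≤ {f} (proj₂ (f=o ε 0<ε)) (ℕ.≤-trans (ℕ.s≤s ℕ.z≤n) y<p)
      (ℕ.≤-trans (ℕ.≤-trans (ℕ.m≤m+n Nf Ng) (ℕ.m≤m+n (Nf ℕ.+ Ng) Nτ)) (ℕ.<⇒≤ (ℕ.<⇒≤ y<p))))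
    (λ p y<p → o⇒prime^-≤ {g} (proj₂ (g=o ε 0<ε)) (ℕ.≤-trans (ℕ.s≤s ℕ.z≤n) y<p)
      (ℕ.≤-trans (ℕ.≤-trans (ℕ.m≤n+m Ng Nf) (ℕ.m≤m+n (Nf ℕ.+ Ng) Nτ)) (ℕ.<⇒≤ (ℕ.<⇒≤ y<p))))
    (proj₁ (proj₂ initial)) (proj₂ (proj₂ initial))
  where
  open Notions R power
  open OrderedField R
  open ComplexNumbers R power
  open RealSums R power
  open Assembly R power
  open Theorem f g h f-mult g-mult g≈f⋆h β δ σ k 0<δ 1/[k+1]+δ<σ β≤σ
  initial = S≪⇒summatoryBound {f} α≤σ Sf≪
  converging = converges⇒tails ∑-pretentious pretentious τ 0<τ
  Nf = proj₁ (f=o ε 0<ε)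
  Ng = proj₁ (g=o ε 0<ε)
  Nτ = proj₁ converging
  tails = proj₂ converging
  -- The sum exceeds all three thresholds at once; `suc` makes Y positive.
  y = suc (Nf ℕ.+ Ng ℕ.+ Nτ)
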